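{- Let $\mathbf{A}\in\mathbb{R}^{n\times n}$ be a symmetric positive semidefinite matrix, let $k\ge 1$ be an integer (the sparsity parameter), and let $\varepsilon\in(0,1]$ be an accuracy parameter such that $\ell:=1/\varepsilon$ is an integer with $\ell\le n$. Let $\mathbf{z}\in\mathbb{R}^n$ be an output of the algorithm \texttt{spca-svd} (described in the context) on input $(\mathbf{A},k,\varepsilon)$. Then $\|\mathbf{z}\|_0\le k/\varepsilon^3$, $\|\mathbf{z}\|_2=1$, and $$\mathbf{z}^\top\mathbf{A}\mathbf{z}\;\ge\;\mathcal{Z}^*-3\varepsilon\,\mathrm{Tr}(\mathbf{A}),$$ where $\mathcal{Z}^*=\max\{\mathbf{x}^\top\mathbf{A}\mathbf{x}:\ \mathbf{x}\in\mathbb{R}^n,\ \|\mathbf{x}\|_2\le 1,\ \|\mathbf{x}\|_0\le k\}$.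
   Context: $\|\mathbf{x}\|_0$ denotes the number of non-zero entries of $\mathbf{x}$, and $\mathrm{Tr}$ is the trace. The singular value decomposition of the PSD matrix $\mathbf{A}$ is written $\mathbf{A}=\mathbf{U}\mathbf{\Sigma}\mathbf{U}^\top$, with $\mathbf{U}$ orthogonal and $\mathbf{\Sigma}$ diagonal with diagonal entries $\sigma_1\ge\sigma_2\ge\dots\ge\sigma_n\ge 0$. Algorithm \texttt{spca-svd} on input $(\mathbf{A},k,\varepsilon)$: (1) Set $\ell=1/\varepsilon$. (2) Compute (exactly) $\mathbf{U}_\ell\in\mathbb{R}^{n\times \ell}$, the matrix of the top $\ell$ singular vectors of $\mathbf{A}$ (the first $\ell$ columns of $\mathbf{U}$), and $\mathbf{\Sigma}_\ell=\mathrm{diag}(\sigma_1,\dots,\sigma_\ell)\in\mathbb{R}^{\ell\times\ell}$. (3) Let $R=\{i_1,\dots,i_{|R|}\}\subseteq\{1,\dots,n\}$ be the set of indices of rows of $\mathbf{U}_\ell$ whose squared Euclidean norm is at least $\varepsilon^2/k$, and let $\mathbf{R}\in\mathbb{R}^{n\times|R|}$ be the matrix with $\mathbf{R}_{i_t,t}=1$ for $t=1,\dots,|R|$ and all other entries zero. (4) Let $\mathbf{y}\in\mathbb{R}^{|R|}$ be a unit vector ($\|\mathbf{y}\|_2=1$) maximizing $\|\mathbf{\Sigma}_\ell^{1/2}\mathbf{U}_\ell^\top\mathbf{R}\mathbf{x}\|_2^2$ over all $\mathbf{x}\in\mathbb{R}^{|R|}$ with $\|\mathbf{x}\|_2=1$.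 (5) Return $\mathbf{z}=\mathbf{R}\mathbf{y}\in\mathbb{R}^n$. An output is any $\mathbf{z}$ obtained in this way, for any choice of singular vectors and of maximizer $\mathbf{y}$. -}

module Defs where

open import Algebra.Bundles using (CommutativeRing; Semiring)
import Algebra.Definitions.RawSemiring as RawSemiringDefinitions
open import Data.Bool.Base using (if_then_else_)
open import Data.Fin.Base as Fin using (Fin; inject≤)
import Data.Fin.Properties as Fin
open import Data.Nat.Base as ℕ using (ℕ)
open import Data.Product.Base using (∃; _×_; _,_; proj₁; proj₂)
open import Data.Sum.Base using (_⊎_; inj₁; inj₂)
import Data.Vec.Base as Vec
open import Data.Vec.Functional using (Vector; toVec)
open import Function.Bundles using (_⇔_)
open import Function.Definitions using (Injective)
open import Level using (Level; suc)
open import Relation.Binary.Core using (Rel)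
open import Relation.Binary.PropositionalEquality.Core using (_≡_)
open import Relation.Binary.Structures using (IsDecTotalOrder)
open import Relation.Nullary.Decidable.Core using (does; ¬?)
open import Relation.Nullary.Negation.Core using (¬_)
open import Relation.Unary using (Pred; Satisfiable)

-- The classical real numbers, axiomatised up to isomorphism as a
-- Dedekind-complete ordered field.  The order is decidable, as it is in
-- classical mathematics.  The inverse is a total operation, of unspecified
-- value at 0#.
record CompleteOrderedField (a : Level) : Set (suc a) where
  field
    commutativeRing : CommutativeRing a a

  open CommutativeRing commutativeRing public

  infix  8 _⁻¹
  infix  4 _≤_

  field
    0#≉1#           : ¬ 0# ≈ 1#
    _⁻¹             : Carrier → Carrier
    ⁻¹-inverseʳ     : ∀ x → ¬ x ≈ 0# → x * x ⁻¹ ≈ 1#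
    _≤_             : Rel Carrier a
    isDecTotalOrder : IsDecTotalOrder _≈_ _≤_
    +-monoˡ-≤       : ∀ z {x y} → x ≤ y → x + z ≤ y + z
    *-nonNegative   : ∀ {x y} → 0# ≤ x → 0# ≤ y → 0# ≤ x * y

  module ≤ = IsDecTotalOrder isDecTotalOrder
  open ≤ public using (_≤?_; _≟_)

  IsUpperBound : Pred Carrier a → Pred Carrier a
  IsUpperBound P b = ∀ x → P x → x ≤ b

  IsSupremum : Pred Carrier a → Pred Carrier a
  IsSupremum P s = IsUpperBound P s × (∀ b → IsUpperBound P b → s ≤ b)

  field
    complete : (P : Pred Carrier a) →
               Satisfiable P → Satisfiable (IsUpperBound P) →
               Satisfiable (IsSupremum P)

module RealArithmetic {a : Level} (ℛ : CompleteOrderedField a) where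

  open CompleteOrderedField ℛ
  open RawSemiringDefinitions (Semiring.rawSemiring semiring) public
    using (sum; _^_)
  open RawSemiringDefinitions (Semiring.rawSemiring semiring)
    using () renaming (_×_ to _×ᴿ_)

  infixl 7 _/_
  infix  4 _<_

  fromℕ : ℕ → Carrier
  fromℕ m = m ×ᴿ 1#

  _/_ : Carrier → Carrier → Carrier
  x / y = x * y ⁻¹

  _<_ : Rel Carrier a
  x < y = x ≤ y × ¬ x ≈ y

  private

    neg-nonNegative : ∀ {x} → x ≤ 0# → 0# ≤ - x
    neg-nonNegative {x} x≤0 =
      ≤.≤-respˡ-≈ (-‿inverseʳ x)
        (≤.≤-respʳ-≈ (+-identityˡ (- x)) (+-monoˡ-≤ (- x) x≤0))

    +-nonNegativeʳ : ∀ x {y} → 0# ≤ y → x ≤ y + x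
    +-nonNegativeʳ x 0≤y = ≤.≤-respˡ-≈ (+-identityˡ x) (+-monoˡ-≤ x 0≤y)

    ≤⇒0≤- : ∀ {x y} → x ≤ y → 0# ≤ y - x
    ≤⇒0≤- {x} x≤y = ≤.≤-respˡ-≈ (-‿inverseʳ x) (+-monoˡ-≤ (- x) x≤y)

    -+-cancel : ∀ x y → (y - x) + x ≈ y
    -+-cancel x y =
      trans (+-assoc y (- x) x)
        (trans (+-congˡ (-‿inverseˡ x)) (+-identityʳ y))

    neg*neg : ∀ x → (- x) * (- x) ≈ x * x
    neg*neg x =
      trans (sym (-‿distribˡ-* x (- x)))
        (trans (-‿cong (sym (-‿distribʳ-* x x))) (-‿involutive (x * x)))
      where open import Algebra.Properties.Ring ring

    square-nonNegative : ∀ x → 0# ≤ x * x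
    square-nonNegative x with ≤.total 0# x
    ... | inj₁ 0≤x = *-nonNegative 0≤x 0≤x
    ... | inj₂ x≤0 =
      ≤.≤-respʳ-≈ (neg*neg x)
        (*-nonNegative (neg-nonNegative x≤0) (neg-nonNegative x≤0))

    0≤1 : 0# ≤ 1#
    0≤1 = ≤.≤-respʳ-≈ (*-identityˡ 1#) (square-nonNegative 1#)

    1≤⇒≤square : ∀ {x} → 1# ≤ x → x ≤ x * x
    1≤⇒≤square {x} 1≤x =
      ≤.≤-respʳ-≈ eq
        (+-nonNegativeʳ x (*-nonNegative (≤⇒0≤- 1≤x) (≤.trans 0≤1 1≤x)))
      where
      eq : (x - 1#) * x + x ≈ x * x
      eq = trans (+-congˡ (sym (*-identityˡ x)))
             (trans (sym (distribʳ x (x - 1#) 1#))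
               (*-congʳ (-+-cancel 1# x)))

    1≤a²+1 : ∀ a → 1# ≤ a * a + 1#
    1≤a²+1 a = +-nonNegativeʳ 1# (square-nonNegative a)

    a≤a²+1 : ∀ a → a ≤ a * a + 1#
    a≤a²+1 a with ≤.total 1# a
    ... | inj₂ a≤1 = ≤.trans a≤1 (1≤a²+1 a)
    ... | inj₁ 1≤a =
      ≤.trans (1≤⇒≤square 1≤a)
        (≤.≤-respʳ-≈ (+-comm 1# (a * a)) (+-nonNegativeʳ (a * a) 0≤1))

  SqrtCut : Carrier → Pred Carrier a
  SqrtCut x t = t ≤ 0# ⊎ t * t ≤ x

  private

    SqrtCut-bounded : ∀ x → IsUpperBound (SqrtCut x) (x * x + 1#)
    SqrtCut-bounded x t (inj₁ t≤0) = ≤.trans t≤0 (≤.trans 0≤1 (1≤a²+1 x))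
    SqrtCut-bounded x t (inj₂ t²≤x) with ≤.total t 1#
    ... | inj₁ t≤1 = ≤.trans t≤1 (1≤a²+1 x)
    ... | inj₂ 1≤t = ≤.trans (≤.trans (1≤⇒≤square 1≤t) t²≤x) (a≤a²+1 x)

  √-supremum : ∀ x → Satisfiable (IsSupremum (SqrtCut x))
  √-supremum x =
    complete (SqrtCut x) (0# , inj₁ ≤.refl) (x * x + 1# , SqrtCut-bounded x)

  -- The nonnegative square root for x ≥ 0; the disjunct t ≤ 0# of the cut
  -- only makes the operation total, with value 0# at negative x.
  √ : Carrier → Carrier
  √ x = proj₁ (√-supremum x)

module LinearAlgebra {a : Level} (ℛ : CompleteOrderedField a) where

  open CompleteOrderedField ℛ
  open RealArithmetic ℛ

  infix  10 _ᵀ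
  infixl 7  _·_
  infixr 7  _*ᵥ_
  infix  4  _≋_

  Matrix : ℕ → ℕ → Set a
  Matrix m n = Vector (Vector Carrier n) m

  _≋_ : ∀ {m n} → Rel (Matrix m n) a
  A ≋ B = ∀ i j → A i j ≈ B i j

  _ᵀ : ∀ {m n} → Matrix m n → Matrix n m
  (A ᵀ) i j = A j i

  _·_ : ∀ {m n p} → Matrix m n → Matrix n p → Matrix m p
  (A · B) i j = sum (λ t → A i t * B t j)

  _*ᵥ_ : ∀ {m n} → Matrix m n → Vector Carrier n → Vector Carrier m
  (A *ᵥ x) i = sum (λ j → A i j * x j)

  diag : ∀ {n} → Vector Carrier n → Matrix n n
  diag d i j = if does (i Fin.≟ j) then d i else 0#

  identity : ∀ {n} → Matrix n n
  identity = diag (λ _ → 1#)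

  Tr : ∀ {n} → Matrix n n → Carrier
  Tr A = sum (λ i → A i i)

  ‖_‖₂ : ∀ {n} → Vector Carrier n → Carrier
  ‖ x ‖₂ = √ (sum (λ i → x i ^ 2))

  ‖_‖₀ : ∀ {n} → Vector Carrier n → ℕ
  ‖ x ‖₀ = Vec.count (λ t → ¬? (t ≟ 0#)) (toVec x)

  -- xᵀ A x
  quadraticForm : ∀ {n} → Matrix n n → Vector Carrier n → Carrier
  quadraticForm A x = sum (λ i → x i * (A *ᵥ x) i)

  Symmetric : ∀ {n} → Matrix n n → Set a
  Symmetric A = A ᵀ ≋ A

  PositiveSemidefinite : ∀ {n} → Matrix n n → Set a
  PositiveSemidefinite A = ∀ x → 0# ≤ quadraticForm A x

  Orthogonal : ∀ {n} → Matrix n n → Set a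
  Orthogonal U = (U ᵀ · U ≋ identity) × (U · U ᵀ ≋ identity)

  record IsSVD {n} (A U : Matrix n n) (σ : Vector Carrier n) : Set a where
    field
      orthogonal    : Orthogonal U
      decreasing    : ∀ i j → i Fin.≤ j → σ j ≤ σ i
      nonNegative   : ∀ i → 0# ≤ σ i
      factorisation : A ≋ U · diag σ · U ᵀ

  firstColumns : ∀ {m n l} → l ℕ.≤ n → Matrix m n → Matrix m l
  firstColumns l≤n U i j = U i (inject≤ j l≤n)

  firstEntries : ∀ {n l} → l ℕ.≤ n → Vector Carrier n → Vector Carrier l
  firstEntries l≤n σ j = σ (inject≤ j l≤n)

  selectionMatrix : ∀ {n r} → (Fin r → Fin n) → Matrix n r
  selectionMatrix ι i t = if does (i Fin.≟ ι t) then 1# else 0#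

  IsMaximiser : ∀ {b c} {X : Set b} →
                (X → Carrier) → Pred X c → Pred X _
  IsMaximiser f C y = C y × (∀ x → C x → f x ≤ f y)

  IsMaximum : ∀ {b c} {X : Set b} →
              (X → Carrier) → Pred X c → Pred Carrier _
  IsMaximum f C m = ∃ λ y → IsMaximiser f C y × m ≈ f y

module SparsePCA {a : Level} (ℛ : CompleteOrderedField a) where

  open CompleteOrderedField ℛ
  open RealArithmetic ℛ
  open LinearAlgebra ℛ

  -- z is an output of spca-svd on input (A , k , ε), where l is the integer
  -- 1/ε.  The fields U, ι and y are the choices left open by the algorithm.
  record IsSpcaSvdOutput {n : ℕ} (A : Matrix n n) (k : ℕ) (ε : Carrier)
                         {l : ℕ} (l≤n : l ℕ.≤ n)
                         (z : Vector Carrier n) : Set a where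
    field
      U     : Matrix n n
      σ     : Vector Carrier n
      isSVD : IsSVD A U σ

    Uₗ : Matrix n l
    Uₗ = firstColumns l≤n U

    √Σₗ : Matrix l l
    √Σₗ = diag (λ j → √ (firstEntries l≤n σ j))

    field
      -- ι 0 , … , ι (r - 1) enumerates the selected rows without repetition.
      r           : ℕ
      ι           : Fin r → Fin n
      ι-injective : Injective _≡_ _≡_ ι
      ι-selects   : ∀ i → (∃ λ t → ι t ≡ i) ⇔
                          (ε ^ 2 / fromℕ k ≤ ‖ Uₗ i ‖₂ ^ 2)

    R : Matrix n r
    R = selectionMatrix ι

    objective : Vector Carrier r → Carrier
    objective x = ‖ √Σₗ *ᵥ Uₗ ᵀ *ᵥ R *ᵥ x ‖₂ ^ 2

    field
      y         : Vector Carrier r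
      y-optimal : IsMaximiser objective (λ x → ‖ x ‖₂ ≈ 1#) y
      z≈Ry      : ∀ i → z i ≈ (R *ᵥ y) i

  Feasible : ∀ {n} → ℕ → Pred (Vector Carrier n) a
  Feasible k x = ‖ x ‖₂ ≤ 1# × ‖ x ‖₀ ℕ.≤ k

  IsOptimalValue : ∀ {n} → Matrix n n → ℕ → Pred Carrier a
  IsOptimalValue A k = IsMaximum (quadraticForm A) (Feasible k)

-- Let x be feasible, T = Tr A, and let x₁ be the restriction of x to the selected
-- rows, x₂ = x - x₁.  Passing from A to its truncation Uₗ Σₗ Uₗᵀ costs at most ε T
-- at x, because l σⱼ ≤ T for the discarded σⱼ and l = 1 / ε.  Passing from x to x₁
-- costs at most 2 ε T: x₂ has at most k nonzero entries, all in rows of Uₗ of squared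
-- norm below ε² / k, so ‖Uₗᵀ x₂‖² ≤ ε² by Cauchy–Schwarz.  Finally x₁ competes with the
-- output in the optimisation over selected rows.  The sparsity bound counts rows:
-- the squared row norms of Uₗ sum to l.

module Submission where

open import Defs
open import Data.Bool.Base using (if_then_else_)
open import Data.Fin.Base as Fin using (Fin; zero; suc; inject≤; punchIn; toℕ)
import Data.Fin.Properties as Fin
open import Data.Fin.Properties using (punchInᵢ≢i)
open import Data.Nat.Base as ℕ using (ℕ; zero; suc; z≤n; s≤s)
import Data.Nat.Properties as ℕ
open import Data.Product.Base using (∃; _×_; _,_; proj₁; proj₂)
open import Data.Sum.Base using (_⊎_; inj₁; inj₂)
open import Data.Vec.Functional using (Vector)
open import Function.Base using (_∘_)
open import Function.Bundles using (Equivalence)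
open import Function.Definitions using (Injective)
open import Level using (Level)
open import Relation.Binary.Bundles using (Poset)
open import Relation.Binary.PropositionalEquality.Core as ≡ using (_≡_; _≢_)
open import Relation.Nullary using (¬_; Dec; yes; no; does; contradiction)

-- Let q be the form of the truncation. It sees x₂ only through Uₗᵀ x₂, so small rows of Uₗ make q
-- x₂ small, whereas A would also see the discarded directions; hence the truncation comes before
-- the restriction to rows. With σⱼ ≤ T this gives q x₂ ≤ ε² T, while q x and q x₁ are at most T.
-- Cauchy-Schwarz for q would bound each of the two cross terms in q x - q x₁ by √(ε² T · T) = ε T,
-- which is the origin of 2 ε T. Roots are avoided by bounding 2 ε (q x - q x₁) by 2 q x₂ + ε² (q x
-- + q x₁) ≤ 4 ε² T and cancelling 2 ε.
--
-- The objective of the algorithm is q itself at R w, and q lies below the form of A, so returning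
-- from q to A at the output is free. The obstacle in comparing x₁ with the output is that the
-- algorithm maximises over the unit sphere, while x₁ lies only in the unit ball; homogeneity of q
-- closes this gap.
--
-- The threshold ε² / k serves both bounds: k rows below it have total mass at most ε², and at most
-- l k / ε² = k / ε³ rows reach it.

-- Ordered-field arithmetic and the square root.

module OrderedField {a : Level} (ℛ : CompleteOrderedField a) where

  open CompleteOrderedField ℛ
  open RealArithmetic ℛ
  open import Algebra.Properties.Ring ring
    using (-‿distribˡ-*; -‿distribʳ-*; -‿involutive; //-rightDividesˡ)
  open import Algebra.Solver.Ring.NaturalCoefficients.Default commutativeSemiring

  poset : Poset a a a
  poset = record { isPartialOrder = ≤.isPartialOrder }

  module ≤-Reasoning where
    open import Relation.Binary.Reasoning.PartialOrder poset public

  open ≤-Reasoning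

  +-monoʳ-≤ : ∀ x {y z} → y ≤ z → x + y ≤ x + z
  +-monoʳ-≤ x {y} {z} y≤z = begin
    x + y  ≈⟨ +-comm x y ⟩
    y + x  ≤⟨ +-monoˡ-≤ x y≤z ⟩
    z + x  ≈⟨ +-comm z x ⟩
    x + z  ∎

  +-mono-≤ : ∀ {x y u v} → x ≤ y → u ≤ v → x + u ≤ y + v
  +-mono-≤ {y = y} {u} x≤y u≤v = ≤.trans (+-monoˡ-≤ u x≤y) (+-monoʳ-≤ y u≤v)

  +-nonNegative : ∀ {x y} → 0# ≤ x → 0# ≤ y → 0# ≤ x + y
  +-nonNegative 0≤x 0≤y = ≤.≤-respˡ-≈ (+-identityˡ 0#) (+-mono-≤ 0≤x 0≤y)

  x≤x+y : ∀ x {y} → 0# ≤ y → x ≤ x + y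
  x≤x+y x 0≤y = ≤.≤-respˡ-≈ (+-identityʳ x) (+-monoʳ-≤ x 0≤y)

  x≤y+x : ∀ x {y} → 0# ≤ y → x ≤ y + x
  x≤y+x x 0≤y = ≤.≤-respˡ-≈ (+-identityˡ x) (+-monoˡ-≤ x 0≤y)

  x-y+y≈x : ∀ x y → (x - y) + y ≈ x
  x-y+y≈x x y = //-rightDividesˡ y x

  x≤y⇒0≤y-x : ∀ {x y} → x ≤ y → 0# ≤ y - x
  x≤y⇒0≤y-x {x} x≤y = ≤.≤-respˡ-≈ (-‿inverseʳ x) (+-monoˡ-≤ (- x) x≤y)

  +-cancelʳ-≤ : ∀ z {x y} → x + z ≤ y + z → x ≤ y
  +-cancelʳ-≤ z {x} {y} x+z≤y+z = begin
    x              ≈⟨ cancel x ⟨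
    (x + z) - z    ≤⟨ +-monoˡ-≤ (- z) x+z≤y+z ⟩
    (y + z) - z    ≈⟨ cancel y ⟩
    y              ∎
    where
    cancel : ∀ t → (t + z) - z ≈ t
    cancel t = trans (+-assoc t z (- z)) (trans (+-congˡ (-‿inverseʳ z)) (+-identityʳ t))

  x≤y+z⇒x-z≤y : ∀ {x y} z → x ≤ y + z → x - z ≤ y
  x≤y+z⇒x-z≤y {x} z x≤y+z = +-cancelʳ-≤ z (≤.≤-respˡ-≈ (sym (x-y+y≈x x z)) x≤y+z)

  *-monoʳ-≤ : ∀ {z} → 0# ≤ z → ∀ {x y} → x ≤ y → z * x ≤ z * y
  *-monoʳ-≤ {z} 0≤z {x} {y} x≤y = begin
    z * x                ≤⟨ x≤y+x (z * x) (*-nonNegative 0≤z (x≤y⇒0≤y-x x≤y)) ⟩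
    z * (y - x) + z * x  ≈⟨ distribˡ z (y - x) x ⟨
    z * ((y - x) + x)    ≈⟨ *-congˡ (x-y+y≈x y x) ⟩
    z * y                ∎

  *-monoˡ-≤ : ∀ {z} → 0# ≤ z → ∀ {x y} → x ≤ y → x * z ≤ y * z
  *-monoˡ-≤ {z} 0≤z {x} {y} x≤y = begin
    x * z  ≈⟨ *-comm x z ⟩
    z * x  ≤⟨ *-monoʳ-≤ 0≤z x≤y ⟩
    z * y  ≈⟨ *-comm z y ⟩
    y * z  ∎

  *-mono-≤ : ∀ {x y u v} → 0# ≤ y → 0# ≤ u → x ≤ y → u ≤ v → x * u ≤ y * v
  *-mono-≤ 0≤y 0≤u x≤y u≤v = ≤.trans (*-monoˡ-≤ 0≤u x≤y) (*-monoʳ-≤ 0≤y u≤v)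

  *-cancelˡ-≈ : ∀ {z} → ¬ z ≈ 0# → ∀ {x y} → z * x ≈ z * y → x ≈ y
  *-cancelˡ-≈ {z} z≉0 {x} {y} zx≈zy =
    trans (sym (undo x)) (trans (*-congˡ zx≈zy) (undo y))
    where
    undo : ∀ t → z ⁻¹ * (z * t) ≈ t
    undo t = trans (solve 3 (λ z z⁻¹ t → z⁻¹ :* (z :* t) := (z :* z⁻¹) :* t) refl z (z ⁻¹) t)
               (trans (*-congʳ (⁻¹-inverseʳ z z≉0)) (*-identityˡ t))

  0<⇒≉0 : ∀ {z} → 0# < z → ¬ z ≈ 0#
  0<⇒≉0 (_ , 0≉z) z≈0 = 0≉z (sym z≈0)

  -- In the unwanted case y ≤ x, monotonicity gives the reverse inequality of the products, so they
  -- are equal and z cancels.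
  *-cancelˡ-≤ : ∀ {z} → 0# < z → ∀ {x y} → z * x ≤ z * y → x ≤ y
  *-cancelˡ-≤ 0<z {x} {y} zx≤zy with ≤.total x y
  ... | inj₁ x≤y = x≤y
  ... | inj₂ y≤x = ≤.reflexive
    (*-cancelˡ-≈ (0<⇒≉0 0<z) (≤.antisym zx≤zy (*-monoʳ-≤ (proj₁ 0<z) y≤x)))

  *-pos : ∀ {x y} → 0# < x → 0# < y → 0# < x * y
  *-pos {x} 0<x 0<y = *-nonNegative (proj₁ 0<x) (proj₁ 0<y) ,
    λ 0≈xy → proj₂ 0<y (*-cancelˡ-≈ (0<⇒≉0 0<x) (trans (zeroʳ x) 0≈xy))

  x*[y/x]≈y : ∀ {x} → ¬ x ≈ 0# → ∀ y → x * (y / x) ≈ y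
  x*[y/x]≈y {x} x≉0 y =
    trans (solve 3 (λ x y x⁻¹ → x :* (y :* x⁻¹) := (x :* x⁻¹) :* y) refl x y (x ⁻¹))
      (trans (*-congʳ (⁻¹-inverseʳ x x≉0)) (*-identityˡ y))

  square-nonNegative : ∀ x → 0# ≤ x * x
  square-nonNegative x with ≤.total 0# x
  ... | inj₁ 0≤x = *-nonNegative 0≤x 0≤x
  ... | inj₂ x≤0 = ≤.≤-respʳ-≈ -x*-x≈x*x (*-nonNegative 0≤-x 0≤-x)
    where
    0≤-x : 0# ≤ - x
    0≤-x = ≤.≤-respʳ-≈ (+-identityˡ (- x)) (x≤y⇒0≤y-x x≤0)
    -x*-x≈x*x : (- x) * (- x) ≈ x * x
    -x*-x≈x*x = trans (sym (-‿distribˡ-* x (- x)))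
      (trans (-‿cong (sym (-‿distribʳ-* x x))) (-‿involutive (x * x)))

  0≤1 : 0# ≤ 1#
  0≤1 = ≤.≤-respʳ-≈ (*-identityˡ 1#) (square-nonNegative 1#)

  -- The gap is the square of d = x - y. The solver works in commutative semirings, without
  -- subtraction, so x enters it as d + y.
  xy+xy≤xx+yy : ∀ x y → x * y + x * y ≤ x * x + y * y
  xy+xy≤xx+yy x y = begin
    x * y + x * y                      ≤⟨ x≤y+x _ (square-nonNegative d) ⟩
    d * d + (x * y + x * y)            ≈⟨ +-congˡ (+-cong x*y x*y) ⟩
    d * d + ((d + y) * y + (d + y) * y)
      ≈⟨ solve 2 (λ d y → d :* d :+ ((d :+ y) :* y :+ (d :+ y) :* y)
                       := (d :+ y) :* (d :+ y) :+ y :* y) refl d y ⟩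
    (d + y) * (d + y) + y * y          ≈⟨ +-congʳ (*-cong d+y≈x d+y≈x) ⟩
    x * x + y * y                      ∎
    where
    d = x - y
    d+y≈x = x-y+y≈x x y
    x*y = *-congʳ (sym d+y≈x)

  -- No sign is assumed of x. If y ≤ x and x is nonzero, then x x ≤ y y ≤ x y, and the positive x
  -- cancels.
  square-cancel-≤ : ∀ {x y} → 0# ≤ y → x * x ≤ y * y → x ≤ y
  square-cancel-≤ {x} {y} 0≤y xx≤yy with ≤.total x y | 0# ≟ x
  ... | inj₁ x≤y | _       = x≤y
  ... | inj₂ y≤x | yes 0≈x = ≤.≤-respˡ-≈ 0≈x 0≤y
  ... | inj₂ y≤x | no  0≉x = *-cancelˡ-≤ (≤.trans 0≤y y≤x , 0≉x)
    (≤.trans xx≤yy (*-monoˡ-≤ 0≤y y≤x))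

  x^2≈x*x : ∀ x → x ^ 2 ≈ x * x
  x^2≈x*x x = *-congˡ (*-identityʳ x)

  0≤fromℕ : ∀ m → 0# ≤ fromℕ m
  0≤fromℕ zero    = ≤.refl
  0≤fromℕ (suc m) = +-nonNegative 0≤1 (0≤fromℕ m)

  0<fromℕ : ∀ {m} → 1 ℕ.≤ m → 0# < fromℕ m
  0<fromℕ {suc m} _ = 0≤fromℕ (suc m) ,
    λ 0≈1+m → 0#≉1# (≤.antisym 0≤1 (≤.≤-respʳ-≈ (sym 0≈1+m) (x≤x+y 1# (0≤fromℕ m))))

  fromℕ-mono-≤ : ∀ {m n} → m ℕ.≤ n → fromℕ m ≤ fromℕ n
  fromℕ-mono-≤ {n = n} z≤n = 0≤fromℕ n
  fromℕ-mono-≤ (s≤s m≤n)   = +-monoʳ-≤ 1# (fromℕ-mono-≤ m≤n)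

  √-nonNegative : ∀ x → 0# ≤ √ x
  √-nonNegative x = proj₁ (proj₂ (√-supremum x)) 0# (inj₁ ≤.refl)

  -- With d = x - s² and δ = d / (1 + 2s + d) ≤ 1, one has
  -- (s + δ)² ≤ s² + (2s + 1) δ ≤ x, so s + δ is still in the cut.
  x≤√x*√x : ∀ {x} → 0# ≤ x → x ≤ √ x * √ x
  x≤√x*√x {x} 0≤x with x ≤? √ x * √ x
  ... | yes x≤ss = x≤ss
  ... | no  x≰ss = contradiction (≤.reflexive x≈ss) x≰ss
    where
    s  = √ x
    d  = x - s * s
    e  = 1# + (s + s)
    δ  = d / (e + d)
    0≤s = √-nonNegative x
    ss≤x : s * s ≤ x
    ss≤x with ≤.total x (s * s)
    ... | inj₁ x≤ss = contradiction x≤ss x≰ss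
    ... | inj₂ le   = le
    0≤d : 0# ≤ d
    0≤d = x≤y⇒0≤y-x ss≤x
    1≤e : 1# ≤ e
    1≤e = x≤x+y 1# (+-nonNegative 0≤s 0≤s)
    1≤e+d : 1# ≤ e + d
    1≤e+d = ≤.trans 1≤e (x≤x+y e 0≤d)
    0<e+d : 0# < e + d
    0<e+d = ≤.trans 0≤1 1≤e+d , λ 0≈ → 0#≉1# (≤.antisym 0≤1 (≤.≤-respʳ-≈ (sym 0≈) 1≤e+d))
    [e+d]δ≈d : (e + d) * δ ≈ d
    [e+d]δ≈d = x*[y/x]≈y (0<⇒≉0 0<e+d) d
    0≤δ : 0# ≤ δ
    0≤δ = *-cancelˡ-≤ 0<e+d (≤.≤-respˡ-≈ (sym (zeroʳ _)) (≤.≤-respʳ-≈ (sym [e+d]δ≈d) 0≤d))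
    δ≤1 : δ ≤ 1#
    δ≤1 = *-cancelˡ-≤ 0<e+d (begin
      (e + d) * δ   ≈⟨ [e+d]δ≈d ⟩
      d             ≤⟨ x≤y+x d (≤.trans 0≤1 1≤e) ⟩
      e + d         ≈⟨ *-identityʳ _ ⟨
      (e + d) * 1#  ∎)
    s+δ-below : (s + δ) * (s + δ) ≤ x
    s+δ-below = begin
      (s + δ) * (s + δ)
        ≈⟨ solve 2 (λ s δ → (s :+ δ) :* (s :+ δ) := (s :* s :+ (s :+ s) :* δ) :+ δ :* δ) refl s δ ⟩
      (s * s + (s + s) * δ) + δ * δ   ≤⟨ +-monoʳ-≤ _ (*-monoˡ-≤ 0≤δ δ≤1) ⟩
      (s * s + (s + s) * δ) + 1# * δ
        ≈⟨ solve 3 (λ s δ u → (s :* s :+ (s :+ s) :* δ) :+ u :* δ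
                         := s :* s :+ (u :+ (s :+ s)) :* δ) refl s δ 1# ⟩
      s * s + e * δ                   ≤⟨ +-monoʳ-≤ _ (*-monoˡ-≤ 0≤δ (x≤x+y e 0≤d)) ⟩
      s * s + (e + d) * δ             ≈⟨ +-congˡ [e+d]δ≈d ⟩
      s * s + d                       ≈⟨ +-comm _ _ ⟩
      d + s * s                       ≈⟨ x-y+y≈x x (s * s) ⟩
      x                               ∎
    δ≤0 : δ ≤ 0#
    δ≤0 = +-cancelʳ-≤ s (begin
      δ + s   ≈⟨ +-comm δ s ⟩
      s + δ   ≤⟨ proj₁ (proj₂ (√-supremum x)) (s + δ) (inj₂ s+δ-below) ⟩
      s       ≈⟨ +-identityˡ s ⟨
      0# + s  ∎)
    d≈0 : d ≈ 0#
    d≈0 = trans (sym [e+d]δ≈d) (trans (*-congˡ (≤.antisym δ≤0 0≤δ)) (zeroʳ _))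
    x≈ss : x ≈ s * s
    x≈ss = trans (sym (x-y+y≈x x (s * s))) (trans (+-congʳ d≈0) (+-identityˡ _))

  -- With d = s² - x and δ = d / 2s, the number s - δ = (s + x / s) / 2 is a
  -- nonnegative upper bound of the cut, so δ ≤ 0.
  √x*√x≤x : ∀ {x} → 0# ≤ x → √ x * √ x ≤ x
  √x*√x≤x {x} 0≤x with √ x * √ x ≤? x
  ... | yes ss≤x = ss≤x
  ... | no  ss≰x = contradiction (≤.reflexive ss≈x) ss≰x
    where
    s  = √ x
    d  = s * s - x
    δ  = d / (s + s)
    b  = s - δ
    0≤s = √-nonNegative x
    x≤ss = x≤√x*√x 0≤x
    0≤d : 0# ≤ d
    0≤d = x≤y⇒0≤y-x x≤ss
    s≉0 : ¬ s ≈ 0#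
    s≉0 s≈0 = ss≰x (≤.≤-respˡ-≈ (sym (trans (*-congʳ s≈0) (zeroˡ s))) 0≤x)
    0<s+s : 0# < s + s
    0<s+s = +-nonNegative 0≤s 0≤s ,
      λ 0≈s+s → s≉0 (≤.antisym (≤.≤-respʳ-≈ (sym 0≈s+s) (x≤x+y s 0≤s)) 0≤s)
    2sδ≈d : (s + s) * δ ≈ d
    2sδ≈d = x*[y/x]≈y (0<⇒≉0 0<s+s) d
    0≤δ : 0# ≤ δ
    0≤δ = *-cancelˡ-≤ 0<s+s (≤.≤-respˡ-≈ (sym (zeroʳ _)) (≤.≤-respʳ-≈ (sym 2sδ≈d) 0≤d))
    δ≤s : δ ≤ s
    δ≤s = *-cancelˡ-≤ 0<s+s (begin
      (s + s) * δ    ≈⟨ 2sδ≈d ⟩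
      d              ≤⟨ x≤x+y d 0≤x ⟩
      d + x          ≈⟨ x-y+y≈x (s * s) x ⟩
      s * s          ≤⟨ x≤x+y _ (*-nonNegative 0≤s 0≤s) ⟩
      s * s + s * s  ≈⟨ distribʳ s s s ⟨
      (s + s) * s    ∎)
    b+δ≈s : b + δ ≈ s
    b+δ≈s = x-y+y≈x s δ
    x≤bb : x ≤ b * b
    x≤bb = +-cancelʳ-≤ ((s + s) * δ) (begin
      x + (s + s) * δ            ≈⟨ +-congˡ 2sδ≈d ⟩
      x + d                      ≈⟨ +-comm x d ⟩
      d + x                      ≈⟨ x-y+y≈x (s * s) x ⟩
      s * s                      ≈⟨ *-cong b+δ≈s b+δ≈s ⟨
      (b + δ) * (b + δ)          ≤⟨ x≤x+y _ (square-nonNegative δ) ⟩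
      (b + δ) * (b + δ) + δ * δ
        ≈⟨ solve 2 (λ b δ → (b :+ δ) :* (b :+ δ) :+ δ :* δ
                         := b :* b :+ ((b :+ δ) :+ (b :+ δ)) :* δ) refl b δ ⟩
      b * b + ((b + δ) + (b + δ)) * δ  ≈⟨ +-congˡ (*-congʳ (+-cong b+δ≈s b+δ≈s)) ⟩
      b * b + (s + s) * δ        ∎)
    0≤b : 0# ≤ b
    0≤b = x≤y⇒0≤y-x δ≤s
    b-bound : IsUpperBound (SqrtCut x) b
    b-bound t (inj₁ t≤0)  = ≤.trans t≤0 0≤b
    b-bound t (inj₂ tt≤x) = square-cancel-≤ 0≤b (≤.trans tt≤x x≤bb)
    δ≤0 : δ ≤ 0#
    δ≤0 = +-cancelʳ-≤ b (begin
      δ + b   ≈⟨ +-comm δ b ⟩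
      b + δ   ≈⟨ b+δ≈s ⟩
      s       ≤⟨ proj₂ (proj₂ (√-supremum x)) b b-bound ⟩
      b       ≈⟨ +-identityˡ b ⟨
      0# + b  ∎)
    d≈0 : d ≈ 0#
    d≈0 = trans (sym 2sδ≈d) (trans (*-congˡ (≤.antisym δ≤0 0≤δ)) (zeroʳ _))
    ss≈x : s * s ≈ x
    ss≈x = trans (sym (x-y+y≈x (s * s) x)) (trans (+-congʳ d≈0) (+-identityˡ _))

  √x*√x≈x : ∀ {x} → 0# ≤ x → √ x * √ x ≈ x
  √x*√x≈x 0≤x = ≤.antisym (√x*√x≤x 0≤x) (x≤√x*√x 0≤x)

-- Finite sums: order, single terms and prefixes.

module FiniteSums {a : Level} (ℛ : CompleteOrderedField a) where

  open CompleteOrderedField ℛ hiding (zero)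
  open RealArithmetic ℛ
  open OrderedField ℛ
  open OrderedField.≤-Reasoning ℛ
  open import Algebra.Properties.Semiring.Sum semiring public
    using (∑-distrib-+; ∑-comm; *-distribˡ-sum; *-distribʳ-sum)
  open import Algebra.Properties.Semiring.Sum semiring
    using (sum-cong-≋; sum-remove; sum-replicate-zero)

  sum-cong : ∀ {n} {f g : Vector Carrier n} → (∀ i → f i ≈ g i) → sum f ≈ sum g
  sum-cong = sum-cong-≋

  sum-mono-≤ : ∀ {n} {f g : Vector Carrier n} → (∀ i → f i ≤ g i) → sum f ≤ sum g
  sum-mono-≤ {zero}  f≤g = ≤.refl
  sum-mono-≤ {suc n} f≤g = +-mono-≤ (f≤g zero) (sum-mono-≤ (f≤g ∘ suc))

  sum-zero : ∀ {n} {f : Vector Carrier n} → (∀ i → f i ≈ 0#) → sum f ≈ 0#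
  sum-zero {n} f≈0 = trans (sum-cong f≈0) (sum-replicate-zero n)

  sum-nonNegative : ∀ {n} {f : Vector Carrier n} → (∀ i → 0# ≤ f i) → 0# ≤ sum f
  sum-nonNegative {n} 0≤f = ≤.≤-respˡ-≈ (sum-replicate-zero n) (sum-mono-≤ 0≤f)

  sum-const : ∀ n x → sum {n} (λ _ → x) ≈ fromℕ n * x
  sum-const zero    x = sym (zeroˡ x)
  sum-const (suc n) x = trans (+-cong (sym (*-identityˡ x)) (sum-const n x)) (sym (distribʳ x 1# (fromℕ n)))

  sum-single : ∀ {n} (f : Vector Carrier n) i → (∀ j → i ≢ j → f j ≈ 0#) → sum f ≈ f i
  sum-single {suc n} f i f≈0 = trans (sum-remove {i = i} f)
    (trans (+-congˡ (sum-zero λ j → f≈0 (punchIn i j) (punchInᵢ≢i i j ∘ ≡.sym))) (+-identityʳ (f i)))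

  term≤sum : ∀ {n} {f : Vector Carrier n} → (∀ i → 0# ≤ f i) → ∀ i → f i ≤ sum f
  term≤sum {suc n} {f} 0≤f i = begin
    f i                                ≤⟨ x≤x+y (f i) (sum-nonNegative λ j → 0≤f (punchIn i j)) ⟩
    f i + sum (λ j → f (punchIn i j))  ≈⟨ sum-remove {i = i} f ⟨
    sum f                              ∎

  sum-prefix-≤ : ∀ {l n} (l≤n : l ℕ.≤ n) {f : Vector Carrier n} → (∀ i → 0# ≤ f i) →
                 sum (λ j → f (inject≤ j l≤n)) ≤ sum f
  sum-prefix-≤ {zero}          l≤n 0≤f = sum-nonNegative 0≤f
  sum-prefix-≤ {suc l} {suc n} l≤n 0≤f = +-monoʳ-≤ _ (sum-prefix-≤ (ℕ.s≤s⁻¹ l≤n) (0≤f ∘ suc))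

  -- Terms from index l on are compared with g, and the tail of g is then enlarged to all of g. With
  -- the whole sum on the right, the isometry of the full coordinate vector can be applied to the
  -- truncation error.
  sum-≤-prefix+ : ∀ {l n} (l≤n : l ℕ.≤ n) {f g : Vector Carrier n} → (∀ i → 0# ≤ g i) →
                  (∀ j → l ℕ.≤ toℕ j → f j ≤ g j) →
                  sum f ≤ sum (λ j → f (inject≤ j l≤n)) + sum g
  sum-≤-prefix+ {zero}          l≤n {f} {g} 0≤g f≤g =
    ≤.≤-respʳ-≈ (sym (+-identityˡ _)) (sum-mono-≤ λ j → f≤g j z≤n)
  sum-≤-prefix+ {suc l} {suc n} l≤n {f} {g} 0≤g f≤g = begin
    f zero + sum (f ∘ suc)
      ≤⟨ +-monoʳ-≤ _ (sum-≤-prefix+ (ℕ.s≤s⁻¹ l≤n) (0≤g ∘ suc) (λ j l≤j → f≤g (suc j) (s≤s l≤j))) ⟩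
    f zero + (prefix + sum (g ∘ suc))             ≤⟨ +-monoʳ-≤ _ (+-monoʳ-≤ _ (x≤y+x _ (0≤g zero))) ⟩
    f zero + (prefix + (g zero + sum (g ∘ suc)))  ≈⟨ +-assoc _ _ _ ⟨
    (f zero + prefix) + (g zero + sum (g ∘ suc))  ∎
    where
    prefix = sum (λ j → f (suc (inject≤ j (ℕ.s≤s⁻¹ l≤n))))

-- Inner products, Cauchy-Schwarz and supports.

module InnerProduct {a : Level} (ℛ : CompleteOrderedField a) where

  open CompleteOrderedField ℛ hiding (zero)
  open RealArithmetic ℛ
  open LinearAlgebra ℛ
  open OrderedField ℛ
  open OrderedField.≤-Reasoning ℛ
  open FiniteSums ℛ
  open import Algebra.Solver.Ring.NaturalCoefficients.Default commutativeSemiring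

  infix 8 ⟨_,_⟩

  ⟨_,_⟩ : ∀ {n} → Vector Carrier n → Vector Carrier n → Carrier
  ⟨ x , y ⟩ = sum (λ i → x i * y i)

  ⟨⟩-cong : ∀ {n} {x x′ y y′ : Vector Carrier n} → (∀ i → x i ≈ x′ i) → (∀ i → y i ≈ y′ i) →
            ⟨ x , y ⟩ ≈ ⟨ x′ , y′ ⟩
  ⟨⟩-cong x≈x′ y≈y′ = sum-cong λ i → *-cong (x≈x′ i) (y≈y′ i)

  ⟨x,x⟩-nonNegative : ∀ {n} (x : Vector Carrier n) → 0# ≤ ⟨ x , x ⟩
  ⟨x,x⟩-nonNegative x = sum-nonNegative λ i → square-nonNegative (x i)

  ⟨⟩-scale : ∀ {n} s (x : Vector Carrier n) →
             ⟨ (λ i → s * x i) , (λ i → s * x i) ⟩ ≈ (s * s) * ⟨ x , x ⟩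
  ⟨⟩-scale {n} s x = trans
    (sum-cong λ i → solve 2 (λ s x → (s :* x) :* (s :* x) := (s :* s) :* (x :* x)) refl s (x i))
    (sym (*-distribˡ-sum {n} (s * s) _))

  ⟨x,x⟩≈0⇒x≈0 : ∀ {n} (x : Vector Carrier n) → ⟨ x , x ⟩ ≈ 0# → ∀ i → x i ≈ 0#
  ⟨x,x⟩≈0⇒x≈0 x xx≈0 i with x i ≟ 0#
  ... | yes xᵢ≈0 = xᵢ≈0
  ... | no  xᵢ≉0 = *-cancelˡ-≈ xᵢ≉0 (trans xᵢxᵢ≈0 (sym (zeroʳ (x i))))
    where
    xᵢxᵢ≈0 : x i * x i ≈ 0#
    xᵢxᵢ≈0 = ≤.antisym (≤.≤-respʳ-≈ xx≈0 (term≤sum (λ j → square-nonNegative (x j)) i))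
                       (square-nonNegative (x i))

  -- Induction on the dimension avoids dividing by a norm. After splitting off the first
  -- coordinates, the mixed term is bounded summand by summand with AM-GM for x₀ yᵢ and y₀ xᵢ; the
  -- induction hypothesis handles the rest.
  cauchy-schwarz : ∀ {n} (x y : Vector Carrier n) →
                   ⟨ x , y ⟩ * ⟨ x , y ⟩ ≤ ⟨ x , x ⟩ * ⟨ y , y ⟩
  cauchy-schwarz {zero}  x y = ≤.refl
  cauchy-schwarz {suc n} x y = begin
    (x₀ * y₀ + xy) * (x₀ * y₀ + xy)
      ≈⟨ solve 3 (λ x₀ y₀ xy → (x₀ :* y₀ :+ xy) :* (x₀ :* y₀ :+ xy)
           := (x₀ :* x₀ :* (y₀ :* y₀) :+ xy :* xy) :+ (x₀ :* y₀ :* xy :+ x₀ :* y₀ :* xy)) refl x₀ y₀ xy ⟩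
    (x₀ * x₀ * (y₀ * y₀) + xy * xy) + (x₀ * y₀ * xy + x₀ * y₀ * xy)
      ≤⟨ +-mono-≤ (+-monoʳ-≤ _ (cauchy-schwarz x′ y′)) cross ⟩
    (x₀ * x₀ * (y₀ * y₀) + xx * yy) + (x₀ * x₀ * yy + y₀ * y₀ * xx)
      ≈⟨ solve 4 (λ x₀ y₀ xx yy → (x₀ :* x₀ :* (y₀ :* y₀) :+ xx :* yy) :+ (x₀ :* x₀ :* yy :+ y₀ :* y₀ :* xx)
           := (x₀ :* x₀ :+ xx) :* (y₀ :* y₀ :+ yy)) refl x₀ y₀ xx yy ⟩
    (x₀ * x₀ + xx) * (y₀ * y₀ + yy) ∎
    where
    x₀ = x zero
    y₀ = y zero
    x′ = x ∘ suc
    y′ = y ∘ suc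
    xx = ⟨ x′ , x′ ⟩
    yy = ⟨ y′ , y′ ⟩
    xy = ⟨ x′ , y′ ⟩
    cross : x₀ * y₀ * xy + x₀ * y₀ * xy ≤ x₀ * x₀ * yy + y₀ * y₀ * xx
    cross = begin
      x₀ * y₀ * xy + x₀ * y₀ * xy
        ≈⟨ +-cong (*-distribˡ-sum {n} _ _) (*-distribˡ-sum {n} _ _) ⟩
      sum (λ i → x₀ * y₀ * (x′ i * y′ i)) + sum (λ i → x₀ * y₀ * (x′ i * y′ i))
        ≈⟨ ∑-distrib-+ {n} _ _ ⟨
      sum (λ i → x₀ * y₀ * (x′ i * y′ i) + x₀ * y₀ * (x′ i * y′ i))
        ≤⟨ sum-mono-≤ (λ i → term (x′ i) (y′ i)) ⟩
      sum (λ i → x₀ * x₀ * (y′ i * y′ i) + y₀ * y₀ * (x′ i * x′ i))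
        ≈⟨ ∑-distrib-+ {n} _ _ ⟩
      sum (λ i → x₀ * x₀ * (y′ i * y′ i)) + sum (λ i → y₀ * y₀ * (x′ i * x′ i))
        ≈⟨ +-cong (*-distribˡ-sum {n} _ _) (*-distribˡ-sum {n} _ _) ⟨
      x₀ * x₀ * yy + y₀ * y₀ * xx ∎
      where
      term : ∀ u v → x₀ * y₀ * (u * v) + x₀ * y₀ * (u * v) ≤ x₀ * x₀ * (v * v) + y₀ * y₀ * (u * u)
      term u v = begin
        x₀ * y₀ * (u * v) + x₀ * y₀ * (u * v)
          ≈⟨ solve 4 (λ x₀ y₀ u v → x₀ :* y₀ :* (u :* v) :+ x₀ :* y₀ :* (u :* v)
               := (x₀ :* v) :* (y₀ :* u) :+ (x₀ :* v) :* (y₀ :* u)) refl x₀ y₀ u v ⟩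
        (x₀ * v) * (y₀ * u) + (x₀ * v) * (y₀ * u)
          ≤⟨ xy+xy≤xx+yy (x₀ * v) (y₀ * u) ⟩
        (x₀ * v) * (x₀ * v) + (y₀ * u) * (y₀ * u)
          ≈⟨ solve 4 (λ x₀ y₀ u v → (x₀ :* v) :* (x₀ :* v) :+ (y₀ :* u) :* (y₀ :* u)
               := x₀ :* x₀ :* (v :* v) :+ y₀ :* y₀ :* (u :* u)) refl x₀ y₀ u v ⟩
        x₀ * x₀ * (v * v) + y₀ * y₀ * (u * u) ∎

  ‖x‖*‖x‖≈⟨x,x⟩ : ∀ {n} (x : Vector Carrier n) → ‖ x ‖₂ * ‖ x ‖₂ ≈ ⟨ x , x ⟩
  ‖x‖*‖x‖≈⟨x,x⟩ x = trans (√x*√x≈x (≤.≤-respʳ-≈ (sym eq) (⟨x,x⟩-nonNegative x))) eq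
    where
    eq = sum-cong λ i → x^2≈x*x (x i)

  ‖x‖^2≈⟨x,x⟩ : ∀ {n} (x : Vector Carrier n) → ‖ x ‖₂ ^ 2 ≈ ⟨ x , x ⟩
  ‖x‖^2≈⟨x,x⟩ x = trans (x^2≈x*x _) (‖x‖*‖x‖≈⟨x,x⟩ x)

  ‖x‖≤1⇒⟨x,x⟩≤1 : ∀ {n} (x : Vector Carrier n) → ‖ x ‖₂ ≤ 1# → ⟨ x , x ⟩ ≤ 1#
  ‖x‖≤1⇒⟨x,x⟩≤1 x ‖x‖≤1 = begin
    ⟨ x , x ⟩          ≈⟨ ‖x‖*‖x‖≈⟨x,x⟩ x ⟨
    ‖ x ‖₂ * ‖ x ‖₂    ≤⟨ *-mono-≤ 0≤1 (√-nonNegative _) ‖x‖≤1 ‖x‖≤1 ⟩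
    1# * 1#            ≈⟨ *-identityˡ 1# ⟩
    1#                 ∎

  ‖x‖≈1⇒⟨x,x⟩≈1 : ∀ {n} (x : Vector Carrier n) → ‖ x ‖₂ ≈ 1# → ⟨ x , x ⟩ ≈ 1#
  ‖x‖≈1⇒⟨x,x⟩≈1 x ‖x‖≈1 = trans (sym (‖x‖*‖x‖≈⟨x,x⟩ x)) (trans (*-cong ‖x‖≈1 ‖x‖≈1) (*-identityˡ 1#))

  ⟨x,x⟩≈1⇒‖x‖≈1 : ∀ {n} (x : Vector Carrier n) → ⟨ x , x ⟩ ≈ 1# → ‖ x ‖₂ ≈ 1#
  ⟨x,x⟩≈1⇒‖x‖≈1 x xx≈1 = ≤.antisym
    (square-cancel-≤ 0≤1 (≤.reflexive ‖x‖²≈1²))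
    (square-cancel-≤ (√-nonNegative _) (≤.reflexive (sym ‖x‖²≈1²)))
    where
    ‖x‖²≈1² : ‖ x ‖₂ * ‖ x ‖₂ ≈ 1# * 1#
    ‖x‖²≈1² = trans (‖x‖*‖x‖≈⟨x,x⟩ x) (trans xx≈1 (sym (*-identityˡ 1#)))

  -- The indicator of the support, valued in the field so that sparsity becomes a sum that can be
  -- weighted and exchanged with other sums.
  nonZero : Carrier → Carrier
  nonZero t = if does (t ≟ 0#) then 0# else 1#

  nonZero-nonNegative : ∀ t → 0# ≤ nonZero t
  nonZero-nonNegative t with t ≟ 0#
  ... | yes _ = ≤.refl
  ... | no  _ = 0≤1

  nonZero-idem : ∀ t → nonZero t * nonZero t ≈ nonZero t
  nonZero-idem t with t ≟ 0#
  ... | yes _ = zeroˡ 0#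
  ... | no  _ = *-identityˡ 1#

  nonZero-* : ∀ t → nonZero t * t ≈ t
  nonZero-* t with t ≟ 0#
  ... | yes t≈0 = trans (zeroˡ t) (sym t≈0)
  ... | no  _   = *-identityˡ t

  fromℕ‖x‖₀≈∑nonZero : ∀ {n} (x : Vector Carrier n) → fromℕ ‖ x ‖₀ ≈ sum (λ i → nonZero (x i))
  fromℕ‖x‖₀≈∑nonZero {zero}  x = refl
  fromℕ‖x‖₀≈∑nonZero {suc n} x with x zero ≟ 0#
  ... | yes _ = trans (fromℕ‖x‖₀≈∑nonZero (x ∘ suc)) (sym (+-identityˡ _))
  ... | no  _ = +-congˡ (fromℕ‖x‖₀≈∑nonZero (x ∘ suc))

  -- Masking u by the indicator of the support of x does not change its inner product with x, so the
  -- norm of u may be replaced by that of the masked vector.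
  cauchy-schwarz-on-support : ∀ {n} (u x : Vector Carrier n) →
    ⟨ u , x ⟩ * ⟨ u , x ⟩ ≤ sum (λ i → nonZero (x i) * (u i * u i)) * ⟨ x , x ⟩
  cauchy-schwarz-on-support u x = begin
    ⟨ u , x ⟩ * ⟨ u , x ⟩  ≈⟨ *-cong ux≈vx ux≈vx ⟩
    ⟨ v , x ⟩ * ⟨ v , x ⟩  ≤⟨ cauchy-schwarz v x ⟩
    ⟨ v , v ⟩ * ⟨ x , x ⟩  ≈⟨ *-congʳ (sum-cong vv) ⟩
    sum (λ i → nonZero (x i) * (u i * u i)) * ⟨ x , x ⟩  ∎
    where
    v = λ i → nonZero (x i) * u i
    ux≈vx : ⟨ u , x ⟩ ≈ ⟨ v , x ⟩
    ux≈vx = sum-cong λ i → trans (*-congˡ (sym (nonZero-* (x i))))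
      (solve 3 (λ u χ x → u :* (χ :* x) := (χ :* u) :* x) refl (u i) (nonZero (x i)) (x i))
    vv : ∀ i → v i * v i ≈ nonZero (x i) * (u i * u i)
    vv i = trans (solve 2 (λ χ u → (χ :* u) :* (χ :* u) := (χ :* χ) :* (u :* u)) refl (nonZero (x i)) (u i))
      (*-congʳ (nonZero-idem (x i)))

-- Matrix action, adjoints, diagonal and selection matrices.

module MatrixVector {a : Level} (ℛ : CompleteOrderedField a) where

  open CompleteOrderedField ℛ hiding (zero)
  open RealArithmetic ℛ
  open LinearAlgebra ℛ
  open OrderedField ℛ
  open FiniteSums ℛ
  open InnerProduct ℛ
  open import Algebra.Solver.Ring.NaturalCoefficients.Default commutativeSemiring
  open import Relation.Binary.Reasoning.Setoid setoid

  *ᵥ-congʳ : ∀ {m n} (M : Matrix m n) {x y : Vector Carrier n} →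
             (∀ j → x j ≈ y j) → ∀ i → (M *ᵥ x) i ≈ (M *ᵥ y) i
  *ᵥ-congʳ M x≈y i = sum-cong λ j → *-congˡ (x≈y j)

  *ᵥ-congˡ : ∀ {m n} {M N : Matrix m n} → M ≋ N → ∀ x i → (M *ᵥ x) i ≈ (N *ᵥ x) i
  *ᵥ-congˡ M≋N x i = sum-cong λ j → *-congʳ (M≋N i j)

  *ᵥ-+ : ∀ {m n} (M : Matrix m n) x y i → (M *ᵥ (λ j → x j + y j)) i ≈ (M *ᵥ x) i + (M *ᵥ y) i
  *ᵥ-+ {n = n} M x y i = trans (sum-cong λ j → distribˡ (M i j) (x j) (y j)) (∑-distrib-+ {n} _ _)

  *ᵥ-scale : ∀ {m n} (M : Matrix m n) s x i → (M *ᵥ (λ j → s * x j)) i ≈ s * (M *ᵥ x) i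
  *ᵥ-scale {n = n} M s x i = trans
    (sum-cong λ j → solve 3 (λ m s x → m :* (s :* x) := s :* (m :* x)) refl (M i j) s (x j))
    (sym (*-distribˡ-sum {n} s _))

  *ᵥ-assoc : ∀ {m n p} (M : Matrix m n) (N : Matrix n p) x i →
             ((M · N) *ᵥ x) i ≈ (M *ᵥ N *ᵥ x) i
  *ᵥ-assoc {n = n} {p} M N x i = begin
    sum (λ j → sum (λ t → M i t * N t j) * x j)    ≈⟨ sum-cong (λ j → *-distribʳ-sum {n} (x j) _) ⟩
    sum (λ j → sum (λ t → M i t * N t j * x j))    ≈⟨ ∑-comm (λ j t → M i t * N t j * x j) ⟩
    sum (λ t → sum (λ j → M i t * N t j * x j))
      ≈⟨ sum-cong (λ t → sum-cong λ j → *-assoc (M i t) (N t j) (x j)) ⟩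
    sum (λ t → sum (λ j → M i t * (N t j * x j)))  ≈⟨ sum-cong (λ t → *-distribˡ-sum {p} (M i t) _) ⟨
    sum (λ t → M i t * sum (λ j → N t j * x j))    ∎

  ⟨⟩-adjoint : ∀ {m n} (M : Matrix m n) x y → ⟨ x , M *ᵥ y ⟩ ≈ ⟨ M ᵀ *ᵥ x , y ⟩
  ⟨⟩-adjoint {m} {n} M x y = begin
    sum (λ i → x i * sum (λ j → M i j * y j))    ≈⟨ sum-cong (λ i → *-distribˡ-sum {n} (x i) _) ⟩
    sum (λ i → sum (λ j → x i * (M i j * y j)))  ≈⟨ ∑-comm (λ i j → x i * (M i j * y j)) ⟩
    sum (λ j → sum (λ i → x i * (M i j * y j)))
      ≈⟨ sum-cong (λ j → sum-cong λ i →
           solve 3 (λ x m y → x :* (m :* y) := m :* x :* y) refl (x i) (M i j) (y j)) ⟩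
    sum (λ j → sum (λ i → M i j * x i * y j))    ≈⟨ sum-cong (λ j → *-distribʳ-sum {m} (y j) _) ⟨
    sum (λ j → sum (λ i → M i j * x i) * y j)    ∎

  diag-≡ : ∀ {n} (d : Vector Carrier n) i → diag d i i ≈ d i
  diag-≡ d i with i Fin.≟ i
  ... | yes _  = refl
  ... | no i≢i = contradiction ≡.refl i≢i

  diag-≢ : ∀ {n} (d : Vector Carrier n) {i j} → i ≢ j → diag d i j ≈ 0#
  diag-≢ d {i} {j} i≢j with i Fin.≟ j
  ... | yes i≡j = contradiction i≡j i≢j
  ... | no  _   = refl

  diag-*ᵥ : ∀ {n} (d x : Vector Carrier n) i → (diag d *ᵥ x) i ≈ d i * x i
  diag-*ᵥ d x i = trans
    (sum-single _ i λ j i≢j → trans (*-congʳ (diag-≢ d i≢j)) (zeroˡ (x j)))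
    (*-congʳ (diag-≡ d i))

  identity-*ᵥ : ∀ {n} (x : Vector Carrier n) i → (identity *ᵥ x) i ≈ x i
  identity-*ᵥ x i = trans (diag-*ᵥ (λ _ → 1#) x i) (*-identityˡ (x i))

  parseval : ∀ {n} (U : Matrix n n) → U · U ᵀ ≋ identity → ∀ x → ⟨ U ᵀ *ᵥ x , U ᵀ *ᵥ x ⟩ ≈ ⟨ x , x ⟩
  parseval U UUᵀ≋I x = begin
    ⟨ U ᵀ *ᵥ x , U ᵀ *ᵥ x ⟩  ≈⟨ ⟨⟩-adjoint U x (U ᵀ *ᵥ x) ⟨
    ⟨ x , U *ᵥ U ᵀ *ᵥ x ⟩    ≈⟨ ⟨⟩-cong (λ _ → refl) (λ i → trans (sym (*ᵥ-assoc U (U ᵀ) x i))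
                                  (trans (*ᵥ-congˡ UUᵀ≋I x i) (identity-*ᵥ x i))) ⟩
    ⟨ x , x ⟩                ∎

  module _ {n r} (ι : Fin r → Fin n) where

    private
      R = selectionMatrix ι

    selection-≡ : ∀ t → R (ι t) t ≈ 1#
    selection-≡ t with ι t Fin.≟ ι t
    ... | yes _    = refl
    ... | no ιt≢ιt = contradiction ≡.refl ιt≢ιt

    selection-≢ : ∀ {i t} → i ≢ ι t → R i t ≈ 0#
    selection-≢ {i} {t} i≢ιt with i Fin.≟ ι t
    ... | yes i≡ιt = contradiction i≡ιt i≢ιt
    ... | no  _    = refl

    selection-*ᵥ-∉ : ∀ y {i} → ¬ (∃ λ t → ι t ≡ i) → (R *ᵥ y) i ≈ 0#
    selection-*ᵥ-∉ y i∉ι = sum-zero λ t →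
      trans (*-congʳ (selection-≢ λ i≡ιt → i∉ι (t , ≡.sym i≡ιt))) (zeroˡ (y t))

    selectionᵀ-*ᵥ : ∀ x t → (R ᵀ *ᵥ x) t ≈ x (ι t)
    selectionᵀ-*ᵥ x t = trans
      (sum-single _ (ι t) λ i ιt≢i → trans (*-congʳ (selection-≢ (ιt≢i ∘ ≡.sym))) (zeroˡ (x i)))
      (trans (*-congʳ (selection-≡ t)) (*-identityˡ (x (ι t))))

    module _ (ι-injective : Injective _≡_ _≡_ ι) where

      -- By injectivity, row `ι t` of R has its only 1 in column t; with repetitions several entries
      -- of y would add up there.
      selection-*ᵥ-∈ : ∀ y t → (R *ᵥ y) (ι t) ≈ y t
      selection-*ᵥ-∈ y t = trans
        (sum-single _ t λ t′ t≢t′ → trans (*-congʳ (selection-≢ (t≢t′ ∘ ι-injective))) (zeroˡ (y t′)))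
        (trans (*-congʳ (selection-≡ t)) (*-identityˡ (y t)))

      selection-isometry : ∀ y → ⟨ R *ᵥ y , R *ᵥ y ⟩ ≈ ⟨ y , y ⟩
      selection-isometry y = trans (⟨⟩-adjoint R (R *ᵥ y) y)
        (⟨⟩-cong (λ t → trans (selectionᵀ-*ᵥ (R *ᵥ y) t) (selection-*ᵥ-∈ y t)) (λ _ → refl))

-- The form of A in singular coordinates, and its truncation.

module SingularValues {a : Level} (ℛ : CompleteOrderedField a) where

  open CompleteOrderedField ℛ hiding (zero)
  open RealArithmetic ℛ
  open LinearAlgebra ℛ
  open OrderedField ℛ
  open OrderedField.≤-Reasoning ℛ
  open FiniteSums ℛ
  open InnerProduct ℛ
  open MatrixVector ℛ
  open import Algebra.Solver.Ring.NaturalCoefficients.Default commutativeSemiring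

  module _ {n} {A U : Matrix n n} {σ : Vector Carrier n} (isSVD : IsSVD A U σ) where

    open IsSVD isSVD

    coordinates : Vector Carrier n → Vector Carrier n
    coordinates x = U ᵀ *ᵥ x

    coordinates-isometry : ∀ x → ⟨ coordinates x , coordinates x ⟩ ≈ ⟨ x , x ⟩
    coordinates-isometry = parseval U (proj₂ orthogonal)

    column-norm : ∀ j → sum (λ i → U i j * U i j) ≈ 1#
    column-norm j = trans (proj₁ orthogonal j j) (diag-≡ (λ _ → 1#) j)

    quadraticForm≈∑ : ∀ x → quadraticForm A x ≈
                      sum (λ j → σ j * (coordinates x j * coordinates x j))
    quadraticForm≈∑ x = begin-equality
      ⟨ x , A *ᵥ x ⟩
        ≈⟨ ⟨⟩-cong (λ _ → refl) (λ i → trans (*ᵥ-congˡ factorisation x i)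
             (trans (*ᵥ-assoc (U · diag σ) (U ᵀ) x i) (*ᵥ-assoc U (diag σ) (U ᵀ *ᵥ x) i))) ⟩
      ⟨ x , U *ᵥ diag σ *ᵥ c ⟩      ≈⟨ ⟨⟩-adjoint U x (diag σ *ᵥ c) ⟩
      ⟨ c , diag σ *ᵥ c ⟩           ≈⟨ sum-cong (λ j → trans (*-congˡ (diag-*ᵥ σ c j))
                                         (solve 2 (λ c σ → c :* (σ :* c) := σ :* (c :* c)) refl (c j) (σ j))) ⟩
      sum (λ j → σ j * (c j * c j)) ∎
      where
      c = coordinates x

    Tr≈∑σ : Tr A ≈ sum σ
    Tr≈∑σ = begin-equality
      sum (λ i → A i i)
        ≈⟨ sum-cong (λ i → trans (factorisation i i) (sum-cong λ j → *-congʳ (U·diag i j))) ⟩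
      sum (λ i → sum (λ j → U i j * σ j * U i j))
        ≈⟨ ∑-comm (λ i j → U i j * σ j * U i j) ⟩
      sum (λ j → sum (λ i → U i j * σ j * U i j))
        ≈⟨ sum-cong (λ j → trans
             (sum-cong λ i → solve 2 (λ u σ → u :* σ :* u := σ :* (u :* u)) refl (U i j) (σ j))
             (sym (*-distribˡ-sum {n} (σ j) _))) ⟩
      sum (λ j → σ j * sum (λ i → U i j * U i j))
        ≈⟨ sum-cong (λ j → trans (*-congˡ (column-norm j)) (*-identityʳ (σ j))) ⟩
      sum σ ∎
      where
      U·diag : ∀ i j → (U · diag σ) i j ≈ U i j * σ j
      U·diag i j = trans
        (sum-single _ j λ t j≢t → trans (*-congˡ (diag-≢ σ (j≢t ∘ ≡.sym))) (zeroʳ (U i t)))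
        (*-congˡ (diag-≡ σ j))

    0≤Tr : 0# ≤ Tr A
    0≤Tr = ≤.≤-respʳ-≈ (sym Tr≈∑σ) (sum-nonNegative nonNegative)

    σ≤Tr : ∀ j → σ j ≤ Tr A
    σ≤Tr j = ≤.≤-respʳ-≈ (sym Tr≈∑σ) (term≤sum nonNegative j)

    module _ {l} (l≤n : l ℕ.≤ n) where

      -- Each of the l retained singular values is at least σⱼ, and together they sum to at most the
      -- trace.
      l*σ≤Tr : ∀ j → l ℕ.≤ toℕ j → fromℕ l * σ j ≤ Tr A
      l*σ≤Tr j l≤j = begin
        fromℕ l * σ j                   ≈⟨ sum-const l (σ j) ⟨
        sum {l} (λ _ → σ j)             ≤⟨ sum-mono-≤ (λ i → decreasing (inject≤ i l≤n) j (i≤j i)) ⟩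
        sum (λ i → σ (inject≤ i l≤n))   ≤⟨ sum-prefix-≤ l≤n nonNegative ⟩
        sum σ                           ≈⟨ Tr≈∑σ ⟨
        Tr A                            ∎
        where
        i≤j : ∀ (i : Fin l) → inject≤ i l≤n Fin.≤ j
        i≤j i = ℕ.≤-trans (ℕ.≤-reflexive (Fin.toℕ-inject≤ i l≤n))
                  (ℕ.≤-trans (ℕ.<⇒≤ (Fin.toℕ<n i)) l≤j)

      -- The squared Frobenius norm of Uₗ, counted by columns instead of rows: there are l columns,
      -- each a unit vector.
      ∑-row-norms : sum (λ i → ⟨ firstColumns l≤n U i , firstColumns l≤n U i ⟩) ≈ fromℕ l
      ∑-row-norms = begin-equality
        sum (λ i → sum (λ j → U i (inject≤ j l≤n) * U i (inject≤ j l≤n)))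
          ≈⟨ ∑-comm (λ i j → U i (inject≤ j l≤n) * U i (inject≤ j l≤n)) ⟩
        sum (λ j → sum (λ i → U i (inject≤ j l≤n) * U i (inject≤ j l≤n)))
          ≈⟨ sum-cong (λ j → column-norm (inject≤ j l≤n)) ⟩
        sum {l} (λ _ → 1#)   ≈⟨ sum-const l 1# ⟩
        fromℕ l * 1#         ≈⟨ *-identityʳ (fromℕ l) ⟩
        fromℕ l              ∎

      leadingCoordinates : Vector Carrier n → Vector Carrier l
      leadingCoordinates x j = coordinates x (inject≤ j l≤n)

      -- The quadratic form of the truncation Uₗ Σₗ Uₗᵀ of A.
      truncatedForm : Vector Carrier n → Carrier
      truncatedForm x =
        sum (λ j → firstEntries l≤n σ j * (leadingCoordinates x j * leadingCoordinates x j))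

      private
        term-nonNegative : ∀ x j → 0# ≤ σ j * (coordinates x j * coordinates x j)
        term-nonNegative x j = *-nonNegative (nonNegative j) (square-nonNegative (coordinates x j))

      truncatedForm-nonNegative : ∀ x → 0# ≤ truncatedForm x
      truncatedForm-nonNegative x = sum-nonNegative λ j → term-nonNegative x (inject≤ j l≤n)

      -- Homogeneity of degree two, which carries optimality from the sphere to the ball. The
      -- hypothesis is pointwise because vectors are functions compared entrywise.
      truncatedForm-scale : ∀ s {x y} → (∀ i → x i ≈ s * y i) →
                            truncatedForm x ≈ (s * s) * truncatedForm y
      truncatedForm-scale s {x} {y} x≈sy = trans (sum-cong λ j → trans
          (*-congˡ (*-cong (c≈ (inject≤ j l≤n)) (c≈ (inject≤ j l≤n))))
          (solve 3 (λ σ s c → σ :* ((s :* c) :* (s :* c)) := (s :* s) :* (σ :* (c :* c)))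
             refl (firstEntries l≤n σ j) s (leadingCoordinates y j)))
        (sym (*-distribˡ-sum {l} (s * s) _))
        where
        c≈ : ∀ j → coordinates x j ≈ s * coordinates y j
        c≈ j = trans (*ᵥ-congʳ (U ᵀ) x≈sy j) (*ᵥ-scale (U ᵀ) s y j)

      -- The discarded terms are nonnegative, so replacing the truncation by A at the output loses
      -- nothing.
      truncatedForm≤quadraticForm : ∀ x → truncatedForm x ≤ quadraticForm A x
      truncatedForm≤quadraticForm x =
        ≤.≤-respʳ-≈ (sym (quadraticForm≈∑ x)) (sum-prefix-≤ l≤n (term-nonNegative x))

      truncatedForm≤Tr* : ∀ x → truncatedForm x ≤ Tr A * ⟨ leadingCoordinates x , leadingCoordinates x ⟩
      truncatedForm≤Tr* x = begin
        truncatedForm x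
          ≤⟨ sum-mono-≤ (λ j → *-monoˡ-≤ (square-nonNegative (leadingCoordinates x j))
                                         (σ≤Tr (inject≤ j l≤n))) ⟩
        sum (λ j → Tr A * (leadingCoordinates x j * leadingCoordinates x j))
          ≈⟨ *-distribˡ-sum {l} (Tr A) _ ⟨
        Tr A * ⟨ leadingCoordinates x , leadingCoordinates x ⟩ ∎

      truncatedForm≤Tr : ∀ x → ⟨ x , x ⟩ ≤ 1# → truncatedForm x ≤ Tr A
      truncatedForm≤Tr x xx≤1 = begin
        truncatedForm x                                         ≤⟨ truncatedForm≤Tr* x ⟩
        Tr A * ⟨ leadingCoordinates x , leadingCoordinates x ⟩
          ≤⟨ *-monoʳ-≤ 0≤Tr (sum-prefix-≤ l≤n (λ j → square-nonNegative (coordinates x j))) ⟩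
        Tr A * ⟨ coordinates x , coordinates x ⟩                ≈⟨ *-congˡ (coordinates-isometry x) ⟩
        Tr A * ⟨ x , x ⟩                                        ≤⟨ *-monoʳ-≤ 0≤Tr xx≤1 ⟩
        Tr A * 1#                                               ≈⟨ *-identityʳ (Tr A) ⟩
        Tr A                                                    ∎

      truncation-error : ∀ {ε} → 0# ≤ ε → fromℕ l * ε ≈ 1# → ∀ x → ⟨ x , x ⟩ ≤ 1# →
                         quadraticForm A x ≤ truncatedForm x + ε * Tr A
      truncation-error {ε} 0≤ε lε≈1 x xx≤1 = begin
        quadraticForm A x                                    ≈⟨ quadraticForm≈∑ x ⟩
        sum (λ j → σ j * (c j * c j))
          ≤⟨ sum-≤-prefix+ l≤n (λ j → *-nonNegative 0≤εT (square-nonNegative (c j)))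
               (λ j l≤j → *-monoˡ-≤ (square-nonNegative (c j)) (σ≤εT j l≤j)) ⟩
        truncatedForm x + sum (λ j → ε * Tr A * (c j * c j)) ≈⟨ +-congˡ (*-distribˡ-sum {n} (ε * Tr A) _) ⟨
        truncatedForm x + ε * Tr A * ⟨ c , c ⟩
          ≤⟨ +-monoʳ-≤ _ (*-monoʳ-≤ 0≤εT (≤.≤-respˡ-≈ (sym (coordinates-isometry x)) xx≤1)) ⟩
        truncatedForm x + ε * Tr A * 1#                      ≈⟨ +-congˡ (*-identityʳ _) ⟩
        truncatedForm x + ε * Tr A                           ∎
        where
        c = coordinates x
        0≤εT : 0# ≤ ε * Tr A
        0≤εT = *-nonNegative 0≤ε 0≤Tr
        σ≤εT : ∀ j → l ℕ.≤ toℕ j → σ j ≤ ε * Tr A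
        σ≤εT j l≤j = begin
          σ j                    ≈⟨ *-identityˡ (σ j) ⟨
          1# * σ j               ≈⟨ *-congʳ lε≈1 ⟨
          fromℕ l * ε * σ j      ≈⟨ solve 3 (λ l ε σ → l :* ε :* σ := ε :* (l :* σ)) refl (fromℕ l) ε (σ j) ⟩
          ε * (fromℕ l * σ j)    ≤⟨ *-monoʳ-≤ 0≤ε (l*σ≤Tr j l≤j) ⟩
          ε * Tr A               ∎

      -- With q the form and b its polarisation, q x - q x₁ = b (x₂ , x) + b (x₂ , x₁),
      -- and AM-GM bounds 2 ε b (x₂ , v) by q x₂ + ε² q v.
      truncatedForm-perturbation : ∀ ε {x x₁ x₂} → (∀ i → x i ≈ x₁ i + x₂ i) →
        (ε + ε) * truncatedForm x ≤
        (ε + ε) * truncatedForm x₁ + ((truncatedForm x₂ + (ε * ε) * truncatedForm x)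
                                    + (truncatedForm x₂ + (ε * ε) * truncatedForm x₁))
      truncatedForm-perturbation ε {x} {x₁} {x₂} x≈x₁+x₂ = begin
        (ε + ε) * truncatedForm x
          ≈⟨ *-distribˡ-sum {l} (ε + ε) _ ⟩
        sum (λ j → (ε + ε) * F x j)
          ≤⟨ sum-mono-≤ (λ j → term (inject≤ j l≤n)) ⟩
        sum (λ j → (ε + ε) * F x₁ j + ((F x₂ j + (ε * ε) * F x j) + (F x₂ j + (ε * ε) * F x₁ j)))
          ≈⟨ trans (∑-distrib-+ {l} _ _) (+-cong (sym (*-distribˡ-sum {l} (ε + ε) _))
               (trans (∑-distrib-+ {l} _ _) (+-cong
                 (trans (∑-distrib-+ {l} _ _) (+-congˡ (sym (*-distribˡ-sum {l} (ε * ε) _))))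
                 (trans (∑-distrib-+ {l} _ _) (+-congˡ (sym (*-distribˡ-sum {l} (ε * ε) _))))))) ⟩
        (ε + ε) * truncatedForm x₁ + ((truncatedForm x₂ + (ε * ε) * truncatedForm x)
                                    + (truncatedForm x₂ + (ε * ε) * truncatedForm x₁)) ∎
        where
        F : Vector Carrier n → Vector Carrier l
        F v j = firstEntries l≤n σ j * (leadingCoordinates v j * leadingCoordinates v j)
        term : ∀ j → let s = σ j; c = coordinates x j; p = coordinates x₁ j; q = coordinates x₂ j in
          (ε + ε) * (s * (c * c)) ≤ (ε + ε) * (s * (p * p))
            + ((s * (q * q) + (ε * ε) * (s * (c * c))) + (s * (q * q) + (ε * ε) * (s * (p * p))))
        term j = begin
          (ε + ε) * (s * (c * c))
            ≈⟨ *-congˡ (*-congˡ (trans (*-cong c≈p+q c≈p+q)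
                 (trans (solve 2 (λ p q → (p :+ q) :* (p :+ q) := p :* p :+ (q :* (p :+ q) :+ q :* p)) refl p q)
                   (+-congˡ (+-congʳ (*-congˡ (sym c≈p+q))))))) ⟩
          (ε + ε) * (s * (p * p + (q * c + q * p)))
            ≈⟨ solve 5 (λ ε s p q c → (ε :+ ε) :* (s :* (p :* p :+ (q :* c :+ q :* p)))
                 := (ε :+ ε) :* (s :* (p :* p))
                    :+ s :* ((q :* (ε :* c) :+ q :* (ε :* c)) :+ (q :* (ε :* p) :+ q :* (ε :* p)))) refl ε s p q c ⟩
          (ε + ε) * (s * (p * p))
            + s * ((q * (ε * c) + q * (ε * c)) + (q * (ε * p) + q * (ε * p)))
            ≤⟨ +-monoʳ-≤ _ (*-monoʳ-≤ (nonNegative j)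
                 (+-mono-≤ (xy+xy≤xx+yy q (ε * c)) (xy+xy≤xx+yy q (ε * p)))) ⟩
          (ε + ε) * (s * (p * p))
            + s * ((q * q + (ε * c) * (ε * c)) + (q * q + (ε * p) * (ε * p)))
            ≈⟨ +-congˡ (solve 5 (λ ε s p q c →
                 s :* ((q :* q :+ (ε :* c) :* (ε :* c)) :+ (q :* q :+ (ε :* p) :* (ε :* p)))
                 := ((s :* (q :* q) :+ (ε :* ε) :* (s :* (c :* c)))
                  :+ (s :* (q :* q) :+ (ε :* ε) :* (s :* (p :* p))))) refl ε s p q c) ⟩
          (ε + ε) * (s * (p * p))
            + ((s * (q * q) + (ε * ε) * (s * (c * c))) + (s * (q * q) + (ε * ε) * (s * (p * p)))) ∎
          where
          s = σ j
          c = coordinates x j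
          p = coordinates x₁ j
          q = coordinates x₂ j
          c≈p+q : c ≈ p + q
          c≈p+q = trans (*ᵥ-congʳ (U ᵀ) x≈x₁+x₂ j) (*ᵥ-+ (U ᵀ) x₁ x₂ j)

      -- Each coordinate pairs x with a column of U, and Cauchy-Schwarz keeps only the part of that
      -- column on the support of x. Exchanging the sums regroups these parts into row norms of Uₗ,
      -- the quantity that the selection rule controls.
      leadingCoordinates-on-support : ∀ x → ⟨ x , x ⟩ ≤ 1# →
        ⟨ leadingCoordinates x , leadingCoordinates x ⟩ ≤
        sum (λ i → nonZero (x i) * ⟨ firstColumns l≤n U i , firstColumns l≤n U i ⟩)
      leadingCoordinates-on-support x xx≤1 = begin
        sum (λ j → leadingCoordinates x j * leadingCoordinates x j)
          ≤⟨ sum-mono-≤ (λ j → column (inject≤ j l≤n)) ⟩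
        sum (λ j → sum (λ i → nonZero (x i) * (U i (inject≤ j l≤n) * U i (inject≤ j l≤n))))
          ≈⟨ ∑-comm (λ j i → nonZero (x i) * (U i (inject≤ j l≤n) * U i (inject≤ j l≤n))) ⟩
        sum (λ i → sum (λ j → nonZero (x i) * (U i (inject≤ j l≤n) * U i (inject≤ j l≤n))))
          ≈⟨ sum-cong (λ i → *-distribˡ-sum {l} (nonZero (x i)) _) ⟨
        sum (λ i → nonZero (x i) * ⟨ firstColumns l≤n U i , firstColumns l≤n U i ⟩) ∎
        where
        column : ∀ j → coordinates x j * coordinates x j ≤ sum (λ i → nonZero (x i) * (U i j * U i j))
        column j = begin
          coordinates x j * coordinates x j  ≤⟨ cauchy-schwarz-on-support (λ i → U i j) x ⟩
          weight * ⟨ x , x ⟩                 ≤⟨ *-monoʳ-≤ 0≤weight xx≤1 ⟩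
          weight * 1#                        ≈⟨ *-identityʳ weight ⟩
          weight                             ∎
          where
          weight = sum (λ i → nonZero (x i) * (U i j * U i j))
          0≤weight : 0# ≤ weight
          0≤weight = sum-nonNegative λ i →
            *-nonNegative (nonZero-nonNegative (x i)) (square-nonNegative (U i j))

-- Sparsity, norm and value of the output.

module SpcaSvd {a : Level} (ℛ : CompleteOrderedField a) where

  open CompleteOrderedField ℛ hiding (zero)
  open RealArithmetic ℛ
  open LinearAlgebra ℛ
  open SparsePCA ℛ
  open OrderedField ℛ
  open OrderedField.≤-Reasoning ℛ
  open FiniteSums ℛ
  open InnerProduct ℛ
  open MatrixVector ℛ
  open SingularValues ℛ
  open import Algebra.Solver.Ring.NaturalCoefficients.Default commutativeSemiring

  module _ {n k l : ℕ} {A : Matrix n n} {ε : Carrier} {l≤n : l ℕ.≤ n} {z : Vector Carrier n}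
           (1≤k : 1 ℕ.≤ k) (0<ε : 0# < ε) (l≈1/ε : fromℕ l ≈ 1# / ε)
           (output : IsSpcaSvdOutput A k ε l≤n z) where

    open IsSpcaSvdOutput output
    open IsSVD isSVD using (nonNegative)

    private
      τ = ε ^ 2 / fromℕ k
      q = truncatedForm isSVD l≤n
      0≤ε = proj₁ 0<ε

      kτ≈εε : fromℕ k * τ ≈ ε * ε
      kτ≈εε = trans (x*[y/x]≈y (0<⇒≉0 (0<fromℕ 1≤k)) (ε ^ 2)) (x^2≈x*x ε)

      0≤τ : 0# ≤ τ
      0≤τ = *-cancelˡ-≤ (0<fromℕ 1≤k)
        (≤.≤-respˡ-≈ (sym (zeroʳ _)) (≤.≤-respʳ-≈ (sym kτ≈εε) (square-nonNegative ε)))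

      lε≈1 : fromℕ l * ε ≈ 1#
      lε≈1 = trans (*-congʳ l≈1/ε) (trans (*-comm (1# / ε) ε) (x*[y/x]≈y (0<⇒≉0 0<ε) 1#))

      selected? : ∀ i → Dec (∃ λ t → ι t ≡ i)
      selected? i = Fin.any? λ t → ι t Fin.≟ i

      selected⇒τ≤ : ∀ {i} → (∃ λ t → ι t ≡ i) → τ ≤ ⟨ Uₗ i , Uₗ i ⟩
      selected⇒τ≤ {i} i∈ι = ≤.≤-respʳ-≈ (‖x‖^2≈⟨x,x⟩ (Uₗ i)) (Equivalence.to (ι-selects i) i∈ι)

      unselected⇒≤τ : ∀ {i} → ¬ (∃ λ t → ι t ≡ i) → ⟨ Uₗ i , Uₗ i ⟩ ≤ τ
      unselected⇒≤τ {i} i∉ι with ≤.total τ ⟨ Uₗ i , Uₗ i ⟩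
      ... | inj₂ ≤τ = ≤τ
      ... | inj₁ τ≤ = contradiction
        (Equivalence.from (ι-selects i) (≤.≤-respʳ-≈ (sym (‖x‖^2≈⟨x,x⟩ (Uₗ i))) τ≤)) i∉ι

    output-sparsity : fromℕ ‖ z ‖₀ ≤ fromℕ k / ε ^ 3
    output-sparsity = *-cancelˡ-≤ 0<ε³ (begin
      ε ^ 3 * fromℕ ‖ z ‖₀               ≈⟨ *-congʳ (*-congˡ (x^2≈x*x ε)) ⟩
      -- Of the three factors ε, two become k τ, so that τ can meet the row count; the third later
      -- cancels l.
      ε * (ε * ε) * fromℕ ‖ z ‖₀         ≈⟨ *-congʳ (*-congˡ kτ≈εε) ⟨
      ε * (fromℕ k * τ) * fromℕ ‖ z ‖₀
        ≈⟨ solve 4 (λ ε k τ s → ε :* (k :* τ) :* s := ε :* k :* (s :* τ)) refl ε (fromℕ k) τ (fromℕ ‖ z ‖₀) ⟩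
      ε * fromℕ k * (fromℕ ‖ z ‖₀ * τ)   ≤⟨ *-monoʳ-≤ (*-nonNegative 0≤ε (0≤fromℕ k)) ‖z‖₀τ≤l ⟩
      ε * fromℕ k * fromℕ l
        ≈⟨ solve 3 (λ ε k l → ε :* k :* l := l :* ε :* k) refl ε (fromℕ k) (fromℕ l) ⟩
      fromℕ l * ε * fromℕ k              ≈⟨ *-congʳ lε≈1 ⟩
      1# * fromℕ k                       ≈⟨ *-identityˡ _ ⟩
      fromℕ k                            ≈⟨ x*[y/x]≈y (0<⇒≉0 0<ε³) (fromℕ k) ⟨
      ε ^ 3 * (fromℕ k / ε ^ 3)          ∎)
      where
      0<ε³ : 0# < ε ^ 3
      -- `ε ^ 3` unfolds to ε (ε (ε 1)), so the innermost factor to be shown positive is ε 1.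
      0<ε³ = *-pos 0<ε (*-pos 0<ε (≤.≤-respʳ-≈ (sym (*-identityʳ ε)) 0≤ε ,
        λ 0≈ε1 → proj₂ 0<ε (trans 0≈ε1 (*-identityʳ ε))))
      row : ∀ i → nonZero (z i) * τ ≤ ⟨ Uₗ i , Uₗ i ⟩
      row i with z i ≟ 0#
      ... | yes _ = ≤.≤-respˡ-≈ (sym (zeroˡ τ)) (⟨x,x⟩-nonNegative (Uₗ i))
      ... | no  zᵢ≉0 with selected? i
      ...   | yes i∈ι = ≤.≤-respˡ-≈ (sym (*-identityˡ τ)) (selected⇒τ≤ i∈ι)
      ...   | no  i∉ι = contradiction (trans (z≈Ry i) (selection-*ᵥ-∉ ι y i∉ι)) zᵢ≉0
      ‖z‖₀τ≤l : fromℕ ‖ z ‖₀ * τ ≤ fromℕ l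
      ‖z‖₀τ≤l = begin
        fromℕ ‖ z ‖₀ * τ                  ≈⟨ *-congʳ (fromℕ‖x‖₀≈∑nonZero z) ⟩
        sum (λ i → nonZero (z i)) * τ     ≈⟨ *-distribʳ-sum {n} τ _ ⟩
        sum (λ i → nonZero (z i) * τ)     ≤⟨ sum-mono-≤ row ⟩
        sum (λ i → ⟨ Uₗ i , Uₗ i ⟩)       ≈⟨ ∑-row-norms isSVD l≤n ⟩
        fromℕ l                           ∎

    ⟨y,y⟩≈1 : ⟨ y , y ⟩ ≈ 1#
    ⟨y,y⟩≈1 = ‖x‖≈1⇒⟨x,x⟩≈1 y (proj₁ y-optimal)

    output-norm : ‖ z ‖₂ ≈ 1#
    output-norm = ⟨x,x⟩≈1⇒‖x‖≈1 z
      (trans (⟨⟩-cong z≈Ry z≈Ry) (trans (selection-isometry ι ι-injective y) ⟨y,y⟩≈1))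

    -- Squaring the weights √σⱼ gives back σⱼ, as σⱼ ≥ 0.
    objective≈truncatedForm : ∀ w → objective w ≈ q (R *ᵥ w)
    objective≈truncatedForm w = trans (‖x‖^2≈⟨x,x⟩ (√Σₗ *ᵥ c)) (sum-cong λ j → trans
      (*-cong (diag-*ᵥ √σ c j) (diag-*ᵥ √σ c j))
      (trans (solve 2 (λ s c → (s :* c) :* (s :* c) := (s :* s) :* (c :* c)) refl (√σ j) (c j))
        (*-congʳ (√x*√x≈x (nonNegative (inject≤ j l≤n))))))
      where
      √σ = λ j → √ (firstEntries l≤n σ j)
      c  = leadingCoordinates isSVD l≤n (R *ᵥ w)

    -- A nonzero w is s v with v a unit vector and s² ≤ 1; homogeneity gives s² times the optimum,
    -- which is at most the optimum because q is nonnegative. The zero vector cannot be normalised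
    -- and is treated apart.
    y-optimal-on-ball : ∀ w → ⟨ w , w ⟩ ≤ 1# → q (R *ᵥ w) ≤ q (R *ᵥ y)
    y-optimal-on-ball w ww≤1 with ⟨ w , w ⟩ ≟ 0#
    ... | yes ww≈0 = begin
      -- The zero vector is 0 times itself, so homogeneity yields the value 0.
      q (R *ᵥ w)              ≈⟨ truncatedForm-scale isSVD l≤n 0# Rw≈0*Rw ⟩
      0# * 0# * q (R *ᵥ w)    ≈⟨ trans (*-congʳ (zeroˡ 0#)) (zeroˡ _) ⟩
      0#                      ≤⟨ truncatedForm-nonNegative isSVD l≤n (R *ᵥ y) ⟩
      q (R *ᵥ y)              ∎
      where
      Rw≈0*Rw : ∀ i → (R *ᵥ w) i ≈ 0# * (R *ᵥ w) i
      Rw≈0*Rw i = trans (*ᵥ-congʳ R (λ t → trans (⟨x,x⟩≈0⇒x≈0 w ww≈0 t) (sym (zeroˡ (w t)))) i)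
        (*ᵥ-scale R 0# w i)
    ... | no  ww≉0 = begin
      q (R *ᵥ w)
        ≈⟨ truncatedForm-scale isSVD l≤n s (λ i → trans (*ᵥ-congʳ R w≈sv i) (*ᵥ-scale R s v i)) ⟩
      s * s * q (R *ᵥ v)       ≤⟨ *-monoʳ-≤ (square-nonNegative s) qRv≤qRy ⟩
      s * s * q (R *ᵥ y)       ≈⟨ *-congʳ ss≈ww ⟩
      ⟨ w , w ⟩ * q (R *ᵥ y)   ≤⟨ *-monoˡ-≤ (truncatedForm-nonNegative isSVD l≤n (R *ᵥ y)) ww≤1 ⟩
      1# * q (R *ᵥ y)          ≈⟨ *-identityˡ _ ⟩
      q (R *ᵥ y)               ∎
      where
      s = √ ⟨ w , w ⟩
      ss≈ww : s * s ≈ ⟨ w , w ⟩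
      ss≈ww = √x*√x≈x (⟨x,x⟩-nonNegative w)
      s≉0 : ¬ s ≈ 0#
      s≉0 s≈0 = ww≉0 (trans (sym ss≈ww) (trans (*-congʳ s≈0) (zeroˡ s)))
      v = λ t → w t / s
      w≈sv : ∀ t → w t ≈ s * v t
      w≈sv t = sym (x*[y/x]≈y s≉0 (w t))
      ⟨v,v⟩≈1 : ⟨ v , v ⟩ ≈ 1#
      ⟨v,v⟩≈1 = *-cancelˡ-≈ ww≉0 (trans (*-congʳ (sym ss≈ww))
        (trans (sym (⟨⟩-scale s v)) (trans (sym (⟨⟩-cong w≈sv w≈sv)) (sym (*-identityʳ _)))))
      qRv≤qRy : q (R *ᵥ v) ≤ q (R *ᵥ y)
      qRv≤qRy = begin
        q (R *ᵥ v)    ≈⟨ objective≈truncatedForm v ⟨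
        objective v   ≤⟨ proj₂ y-optimal v (⟨x,x⟩≈1⇒‖x‖≈1 v ⟨v,v⟩≈1) ⟩
        objective y   ≈⟨ objective≈truncatedForm y ⟩
        q (R *ᵥ y)    ∎

    module _ (x : Vector Carrier n) (xx≤1 : ⟨ x , x ⟩ ≤ 1#) (‖x‖₀≤k : ‖ x ‖₀ ℕ.≤ k) where

      private
        -- `x ∘ ι` is Rᵀ x, so x₁ is R Rᵀ x: the restriction of x, already in the form R w that the
        -- algorithm ranges over.
        x₁ = R *ᵥ (x ∘ ι)
        x₂ = λ i → x i - x₁ i

        x≈x₁+x₂ : ∀ i → x i ≈ x₁ i + x₂ i
        x≈x₁+x₂ i = sym (trans (+-comm (x₁ i) (x₂ i)) (x-y+y≈x (x i) (x₁ i)))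

        selected⇒x₁≈x : ∀ {i} → (∃ λ t → ι t ≡ i) → x₁ i ≈ x i
        selected⇒x₁≈x (t , ≡.refl) = selection-*ᵥ-∈ ι ι-injective (x ∘ ι) t

        selected⇒x₂≈0 : ∀ {i} → (∃ λ t → ι t ≡ i) → x₂ i ≈ 0#
        selected⇒x₂≈0 {i} i∈ι = trans (+-congˡ (-‿cong (selected⇒x₁≈x i∈ι))) (-‿inverseʳ (x i))

        unselected⇒x₁≈0 : ∀ {i} → ¬ (∃ λ t → ι t ≡ i) → x₁ i ≈ 0#
        unselected⇒x₁≈0 = selection-*ᵥ-∉ ι (x ∘ ι)

        unselected⇒x₂≈x : ∀ {i} → ¬ (∃ λ t → ι t ≡ i) → x₂ i ≈ x i
        unselected⇒x₂≈x {i} i∉ι =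
          trans (sym (+-identityˡ (x₂ i)))
            (trans (+-congʳ (sym (unselected⇒x₁≈0 i∉ι))) (sym (x≈x₁+x₂ i)))

        ≈x⊎≈0⇒⟨⟩≤1 : ∀ {v : Vector Carrier n} → (∀ i → v i ≈ x i ⊎ v i ≈ 0#) → ⟨ v , v ⟩ ≤ 1#
        ≈x⊎≈0⇒⟨⟩≤1 {v} v≈ = ≤.trans (sum-mono-≤ (λ i → square-≤ i (v≈ i))) xx≤1
          where
          square-≤ : ∀ i → v i ≈ x i ⊎ v i ≈ 0# → v i * v i ≤ x i * x i
          square-≤ i (inj₁ v≈x) = ≤.reflexive (*-cong v≈x v≈x)
          square-≤ i (inj₂ v≈0) =
            ≤.≤-respˡ-≈ (sym (trans (*-congʳ v≈0) (zeroˡ (v i)))) (square-nonNegative (x i))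

        x₁x₁≤1 : ⟨ x₁ , x₁ ⟩ ≤ 1#
        x₁x₁≤1 = ≈x⊎≈0⇒⟨⟩≤1 λ i → case (selected? i)
          where
          case : ∀ {i} → Dec (∃ λ t → ι t ≡ i) → x₁ i ≈ x i ⊎ x₁ i ≈ 0#
          case (yes i∈ι) = inj₁ (selected⇒x₁≈x i∈ι)
          case (no  i∉ι) = inj₂ (unselected⇒x₁≈0 i∉ι)

        x₂x₂≤1 : ⟨ x₂ , x₂ ⟩ ≤ 1#
        x₂x₂≤1 = ≈x⊎≈0⇒⟨⟩≤1 λ i → case (selected? i)
          where
          case : ∀ {i} → Dec (∃ λ t → ι t ≡ i) → x₂ i ≈ x i ⊎ x₂ i ≈ 0#
          case (yes i∈ι) = inj₂ (selected⇒x₂≈0 i∈ι)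
          case (no  i∉ι) = inj₁ (unselected⇒x₂≈x i∉ι)

        -- A nonzero entry of x₂ is an entry of x in an unselected row. Counting over the support of
        -- x, which k bounds, also includes selected rows; the excess is harmless since τ ≥ 0.
        row : ∀ i → nonZero (x₂ i) * ⟨ Uₗ i , Uₗ i ⟩ ≤ nonZero (x i) * τ
        row i with x₂ i ≟ 0# | x i ≟ 0# | selected? i
        ... | yes _    | yes _   | _       = ≤.reflexive (trans (zeroˡ _) (sym (zeroˡ τ)))
        ... | yes _    | no  _   | _       =
          ≤.≤-respˡ-≈ (sym (zeroˡ _)) (≤.≤-respʳ-≈ (sym (*-identityˡ τ)) 0≤τ)
        ... | no  x₂≉0 | _       | yes i∈ι = contradiction (selected⇒x₂≈0 i∈ι) x₂≉0
        ... | no  x₂≉0 | yes x≈0 | no  i∉ι = contradiction (trans (unselected⇒x₂≈x i∉ι) x≈0) x₂≉0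
        ... | no  _    | no  _   | no  i∉ι = *-monoʳ-≤ 0≤1 (unselected⇒≤τ i∉ι)

        T = Tr A

        qx₂≤Tεε : q x₂ ≤ T * (ε * ε)
        qx₂≤Tεε = ≤.trans (truncatedForm≤Tr* isSVD l≤n x₂) (*-monoʳ-≤ (0≤Tr isSVD) (begin
          ⟨ leadingCoordinates isSVD l≤n x₂ , leadingCoordinates isSVD l≤n x₂ ⟩
            ≤⟨ leadingCoordinates-on-support isSVD l≤n x₂ x₂x₂≤1 ⟩
          sum (λ i → nonZero (x₂ i) * ⟨ Uₗ i , Uₗ i ⟩)  ≤⟨ sum-mono-≤ row ⟩
          sum (λ i → nonZero (x i) * τ)                 ≈⟨ *-distribʳ-sum {n} τ _ ⟨
          sum (λ i → nonZero (x i)) * τ                 ≈⟨ *-congʳ (fromℕ‖x‖₀≈∑nonZero x) ⟨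
          fromℕ ‖ x ‖₀ * τ                              ≤⟨ *-monoˡ-≤ 0≤τ (fromℕ-mono-≤ ‖x‖₀≤k) ⟩
          fromℕ k * τ                                   ≈⟨ kτ≈εε ⟩
          ε * ε                                         ∎))

        0<ε+ε : 0# < ε + ε
        0<ε+ε = +-nonNegative 0≤ε 0≤ε ,
          λ 0≈ε+ε → proj₂ 0<ε (≤.antisym 0≤ε (≤.≤-respʳ-≈ (sym 0≈ε+ε) (x≤x+y ε 0≤ε)))

        εε*-mono-≤ : ∀ {u v} → u ≤ v → (ε * ε) * u ≤ (ε * ε) * v
        εε*-mono-≤ = *-monoʳ-≤ (square-nonNegative ε)

        qx≤qx₁+2εT : q x ≤ q x₁ + (ε * T + ε * T)
        qx≤qx₁+2εT = *-cancelˡ-≤ 0<ε+ε (begin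
          (ε + ε) * q x
            ≤⟨ truncatedForm-perturbation isSVD l≤n ε x≈x₁+x₂ ⟩
          (ε + ε) * q x₁ + ((q x₂ + (ε * ε) * q x) + (q x₂ + (ε * ε) * q x₁))
            ≤⟨ +-monoʳ-≤ _ (+-mono-≤
                 (+-mono-≤ qx₂≤Tεε (εε*-mono-≤ (truncatedForm≤Tr isSVD l≤n x xx≤1)))
                 (+-mono-≤ qx₂≤Tεε (εε*-mono-≤ (truncatedForm≤Tr isSVD l≤n x₁ x₁x₁≤1)))) ⟩
          (ε + ε) * q x₁ + ((T * (ε * ε) + (ε * ε) * T) + (T * (ε * ε) + (ε * ε) * T))
            ≈⟨ solve 3 (λ ε q T →
                 (ε :+ ε) :* q :+ ((T :* (ε :* ε) :+ (ε :* ε) :* T) :+ (T :* (ε :* ε) :+ (ε :* ε) :* T))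
                 := (ε :+ ε) :* (q :+ (ε :* T :+ ε :* T))) refl ε (q x₁) T ⟩
          (ε + ε) * (q x₁ + (ε * T + ε * T)) ∎)

      feasible-bound : quadraticForm A x ≤ quadraticForm A z + fromℕ 3 * ε * T
      feasible-bound = begin
        quadraticForm A x                          ≤⟨ truncation-error isSVD l≤n 0≤ε lε≈1 x xx≤1 ⟩
        q x + ε * T                                ≤⟨ +-monoˡ-≤ _ qx≤qx₁+2εT ⟩
        q x₁ + (ε * T + ε * T) + ε * T
          ≤⟨ +-monoˡ-≤ _ (+-monoˡ-≤ _ (y-optimal-on-ball (x ∘ ι) ww≤1)) ⟩
        q (R *ᵥ y) + (ε * T + ε * T) + ε * T
          ≤⟨ +-monoˡ-≤ _ (+-monoˡ-≤ _ (truncatedForm≤quadraticForm isSVD l≤n (R *ᵥ y))) ⟩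
        quadraticForm A (R *ᵥ y) + (ε * T + ε * T) + ε * T
          ≈⟨ +-congʳ (+-congʳ (⟨⟩-cong z≈Ry (*ᵥ-congʳ A z≈Ry))) ⟨
        quadraticForm A z + (ε * T + ε * T) + ε * T
          -- The coefficient is spelled as `fromℕ 3` unfolds, namely 1 + (1 + (1 + 0)).
          ≈⟨ solve 3 (λ v ε T → v :+ (ε :* T :+ ε :* T) :+ ε :* T
               := v :+ (con 1 :+ (con 1 :+ (con 1 :+ con 0))) :* ε :* T) refl (quadraticForm A z) ε T ⟩
        quadraticForm A z + fromℕ 3 * ε * T        ∎
        where
        ww≤1 : ⟨ x ∘ ι , x ∘ ι ⟩ ≤ 1#
        ww≤1 = ≤.≤-respˡ-≈ (selection-isometry ι ι-injective (x ∘ ι)) x₁x₁≤1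

theorem2p1 : ∀ {a : Level} (ℛ : CompleteOrderedField a) →
    let open CompleteOrderedField ℛ
        open RealArithmetic ℛ
        open LinearAlgebra ℛ
        open SparsePCA ℛ
    in
    (n : ℕ) (A : Matrix n n) → Symmetric A → PositiveSemidefinite A →
    (k : ℕ) → 1 ℕ.≤ k →
    (ε : Carrier) → 0# < ε → ε ≤ 1# →
    (l : ℕ) → fromℕ l ≈ 1# / ε → (l≤n : l ℕ.≤ n) →
    (z : Vector Carrier n) → IsSpcaSvdOutput A k ε l≤n z →
    (Z* : Carrier) → IsOptimalValue A k Z* →
    (fromℕ ‖ z ‖₀ ≤ fromℕ k / ε ^ 3) ×
    (‖ z ‖₂ ≈ 1#) ×
    (Z* - fromℕ 3 * ε * Tr A ≤ quadraticForm A z)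
theorem2p1 ℛ n A _ _ k 1≤k ε 0<ε _ l l≈1/ε l≤n z output Z* (x , ((‖x‖≤1 , ‖x‖₀≤k) , _) , Z*≈) =
  output-sparsity 1≤k 0<ε l≈1/ε output ,
  output-norm 1≤k 0<ε l≈1/ε output ,
  -- `Z*` is attained at the feasible point x, so the bound for feasible points applies to it.
  x≤y+z⇒x-z≤y _ (≤.≤-respˡ-≈ (sym Z*≈)
    (feasible-bound 1≤k 0<ε l≈1/ε output x (‖x‖≤1⇒⟨x,x⟩≤1 x ‖x‖≤1) ‖x‖₀≤k))
  where
  open CompleteOrderedField ℛ using (sym; module ≤)
  open OrderedField ℛ using (x≤y+z⇒x-z≤y)
  open InnerProduct ℛ using (‖x‖≤1⇒⟨x,x⟩≤1)
  open SpcaSvd ℛ
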